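{- For every $k\ge1$ and every rainbow pre-coloring tuple $(H, \psi)$ with colors in $[k]$, $$\pi_k^{\ast}(H, \psi) = \pi_k^{\ast}(\{\text{all color homomorphic images of }(H, \psi)\}).$$
   Context: Multigraphs have no loops. For a multigraph $H$ and distinct $u,v$, $E(H)_{uv}$ is the set of edges between $u$ and $v$. A pre-coloring of $H$ is a map $\psi:X\to[k]$, $X=\mathbf{dom}(\psi)\subseteq E(H)$, injective on $E(H)_{uv}\cap X$ for each pair; it is rainbow if injective on $X$. For pre-coloring tuples $(H,\psi_1),(G,\psi_2)$, a color homomorphism is a pair $(f,\tilde f)$ where $f:V(H)\to V(G)$ maps adjacent vertices to adjacent vertices, $\tilde f:E(H)\to E(G)$ is injective with $\tilde f(E(H)_{uv})\subseteq E(G)_{f(u)f(v)}$, $\mathbf{dom}(\psi_2)=\tilde f(\mathbf{dom}(\psi_1))$, and $\psi_1(e)=\psi_2(\tilde f(e))$ for $e\in\mathbf{dom}(\psi_1)$; $(G,\psi_2)$ is a color homomorphic image of $(H,\psi_1)$ if such exists with $\tilde f$ bijective. A graph system of order $k$ on $V$ is a tuple of simple graphs $(G_1,\dots,G_k)$ on $V$; it is rainbow $(F,\rho)$-free if there is no multigraph $F'$ with $V(F')\subseteq V$, isomorphism $\phi:F\to F'$ and injective $\rho':E(F')\to[k]$ with $\rho'\circ\phi$ extending $\rho$ and $e\in E(G_{\rho'(e)})$ for all $e$; it is rainbow $\mathcal{F}$-free for a family $\mathcal{F}$ if it is rainbow $(F,\rho)$-free for all $(F,\rho)\in\mathcal{F}$.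 $\mathrm{ex}_k^*(n,\mathcal{F})$ is the maximum of $\min_i|E(G_i)|$ over rainbow $\mathcal{F}$-free graph systems of order $k$ on $[n]$, and $\pi_k^*(\mathcal{F})=\lim_{n\to\infty}\mathrm{ex}_k^*(n,\mathcal{F})/\binom{n}{2}$; $\pi_k^*(H,\psi)=\pi_k^*(\{(H,\psi)\})$. -}

module Defs where

open import Data.Nat using (ℕ; suc; _+_; _*_; _≤_; _<ᵇ_)
open import Data.Nat.Combinatorics using (_C_)
open import Data.Fin using (Fin; toℕ)
open import Data.Bool using (Bool; true; false; _∧_; if_then_else_)
open import Data.List using (List; map; allFin)
open import Data.Nat.ListAction using (sum)
open import Data.Maybe using (Maybe; just)
open import Data.Product using (Σ; ∃; _×_; _,_; proj₁; proj₂)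
open import Data.Sum using (_⊎_)
open import Relation.Binary.PropositionalEquality using (_≡_; _≢_)
open import Function.Definitions using (Injective; Surjective)

SamePair : ∀ {n} → Fin n × Fin n → Fin n × Fin n → Set
SamePair (a , b) (c , d) = (a ≡ c × b ≡ d) ⊎ (a ≡ d × b ≡ c)

-- A pre-coloring tuple (H, ψ) with colors in [k] (= Fin k).
-- H is a loopless multigraph with vertex set Fin nV and edge set Fin nE;
-- each edge e has endpoints ends e.  ψ is a partial map (Maybe) from
-- edges to colors, its domain being the edges e with col e ≡ just c;
-- it is required to be injective on each E(H)_{uv} ∩ dom ψ.
record PCT (k : ℕ) : Set where
  field
    nV : ℕ
    nE : ℕ
    ends : Fin nE → Fin nV × Fin nV
    noLoop : ∀ e → proj₁ (ends e) ≢ proj₂ (ends e)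
    col : Fin nE → Maybe (Fin k)
    proper : ∀ e e' c → SamePair (ends e) (ends e') →
             col e ≡ just c → col e' ≡ just c → e ≡ e'
open PCT public

Rainbow : ∀ {k} → PCT k → Set
Rainbow H = ∀ e e' c → col H e ≡ just c → col H e' ≡ just c → e ≡ e'

-- Color homomorphism (f, f̃) from (H, ψ₁) to (G, ψ₂).
-- The edge condition f̃(E(H)_{uv}) ⊆ E(G)_{f(u)f(v)} is expressed by the
-- endpoints of f̃ e being the unordered pair {f u, f v}; this also yields
-- that f maps adjacent vertices to adjacent vertices.
record ColorHom {k} (H G : PCT k) : Set where
  field
    f : Fin (nV H) → Fin (nV G)
    f̃ : Fin (nE H) → Fin (nE G)
    f̃-inj : Injective _≡_ _≡_ f̃
    f̃-edge : ∀ e → SamePair (ends G (f̃ e)) (f (proj₁ (ends H e)) , f (proj₂ (ends H e)))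
    dom-to : ∀ e c → col H e ≡ just c → ∃ λ c' → col G (f̃ e) ≡ just c'
    dom-from : ∀ e' c' → col G e' ≡ just c' →
               ∃ λ e → f̃ e ≡ e' × ∃ λ c → col H e ≡ just c
    colors : ∀ e c → col H e ≡ just c → col G (f̃ e) ≡ just c

IsColorHomImage : ∀ {k} → PCT k → PCT k → Set
IsColorHomImage H G = Σ (ColorHom H G) λ φ → Surjective _≡_ _≡_ (ColorHom.f̃ φ)

Family : ℕ → Set₁
Family k = PCT k → Set

Singleton : ∀ {k} → PCT k → Family k
Singleton H F = F ≡ H

AllImages : ∀ {k} → PCT k → Family k
AllImages H G = IsColorHomImage H G

record SimpleGraph (n : ℕ) : Set where
  field
    adj : Fin n → Fin n → Bool
    adj-sym : ∀ u v → adj u v ≡ adj v u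
    adj-irrefl : ∀ u → adj u u ≡ false
open SimpleGraph public

edgeCount : ∀ {n} → SimpleGraph n → ℕ
edgeCount {n} G =
  sum (map (λ u → sum (map (λ v → if (toℕ u <ᵇ toℕ v) ∧ adj G u v then 1 else 0)
                            (allFin n)))
           (allFin n))

GraphSystem : ℕ → ℕ → Set
GraphSystem k n = Fin k → SimpleGraph n

-- A rainbow copy of (F, ρ) in the system: an injective vertex embedding g
-- (the isomorphism φ onto F' with V(F') ⊆ [n]) together with an injective
-- edge coloring ρ'' = ρ' ∘ φ extending ρ such that the image of each edge e
-- lies in G_{ρ'' e}.
RainbowCopy : ∀ {k n} → GraphSystem k n → PCT k → Set
RainbowCopy {k} {n} Gs F =
  Σ (Fin (nV F) → Fin n) λ g → Injective _≡_ _≡_ g ×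
  Σ (Fin (nE F) → Fin k) λ ρ → Injective _≡_ _≡_ ρ ×
    (∀ e c → col F e ≡ just c → ρ e ≡ c) ×
    (∀ e → adj (Gs (ρ e)) (g (proj₁ (ends F e))) (g (proj₂ (ends F e))) ≡ true)

RainbowFree : ∀ {k n} → GraphSystem k n → Family k → Set
RainbowFree Gs 𝓕 = ∀ F → 𝓕 F → RainbowCopy Gs F → Data.Empty.⊥
  where import Data.Empty

-- "lim sup (ex*_k(n,A) - ex*_k(n,B)) / (n choose 2) ≤ 0", i.e. for every
-- ε = 1/(t+1), for all large n:  ex*_k(n,A) ≤ ex*_k(n,B) + ε·(n choose 2).
-- ex*_k(n,A) ≥ m is witnessed by a rainbow A-free system all of whose
-- graphs have at least m edges.
DensityLE : (k : ℕ) → Family k → Family k → Set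
DensityLE k A B =
  ∀ (t : ℕ) → ∃ λ N → ∀ n → N ≤ n →
    ∀ (m : ℕ) (Gs : GraphSystem k n) → RainbowFree Gs A → (∀ i → m ≤ edgeCount (Gs i)) →
      ∃ λ (Gs' : GraphSystem k n) → RainbowFree Gs' B ×
        (∀ i → suc t * m ≤ suc t * edgeCount (Gs' i) + n C 2)

-- π*_k(A) = π*_k(B)  (both limits exist; equality ⇔ difference → 0).
SameDensity : (k : ℕ) → Family k → Family k → Set
SameDensity k A B = DensityLE k A B × DensityLE k B A

{-# OPTIONS --safe #-}
module Submission where

-- A system contains a rainbow copy of some image of H iff it contains a rainbow homomorphic copy of H, not
-- necessarily injective on vertices.  Given an H-free system on a large [n], draw z ∈ [n]^s uniformly for a
-- constant s and replace vertex u by z (π u), where π : [n] → [s] has few collisions.  By a second-moment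
-- estimate the k edge counts are preserved simultaneously up to ε n².  A homomorphic copy in the new system
-- is a map g : V(H) → [s] such that z ∘ g is a homomorphism.  Splitting the vertices identified by g one at
-- a time, with Cauchy–Schwarz at each step, a positive density of such z would force a positive density of
-- homomorphisms V(H) → [n], hence an injective one; so for n large a random z admits no such g.

open import Defs
open import Algebra.Bundles using (CommutativeSemiring)
open import Data.Bool using (Bool; true; false; if_then_else_; _∧_)
import Data.Bool.Properties as Bool
open import Data.Empty using (⊥-elim)
open import Data.Fin using (Fin; zero; suc; toℕ; fromℕ<; _↑ˡ_; _↑ʳ_)
import Data.Fin.Properties as Fin
open import Data.Integer as ℤ using (ℤ; +_; 0ℤ; ∣_∣)
import Data.Integer.Properties as ℤ
open import Data.List as List
  using (List; []; _∷_; _++_; map; length; allFin; cartesianProductWith; cartesianProduct; [_])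
open import Data.List.Membership.Propositional using (_∈_)
open import Data.List.Membership.Propositional.Properties
  using (∈-allFin; ∈-cartesianProductWith⁺; ∈-cartesianProduct⁺; ∈-length)
open import Data.List.Properties using (length-tabulate)
open import Data.List.Relation.Unary.Any using (here; there)
open import Data.Maybe using (just)
import Data.Maybe.Properties as Maybe
open import Data.Nat
  using (ℕ; zero; suc; _+_; _*_; _∸_; _^_; _≤_; _<_; z≤n; s≤s; NonZero; >-nonZero; _≤?_; _<?_; _<ᵇ_)
open import Data.Nat.Combinatorics using (_C_; nC1≡n; nCk+nC[k+1]≡[n+1]C[k+1])
open import Data.Nat.ListAction using (sum)
open import Data.Nat.Tactic.RingSolver using (solve-∀)
open import Data.Product using (∃; _×_; _,_; proj₁; proj₂)
open import Data.Sum using (inj₁; inj₂; [_,_]′)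
open import Data.Vec using (Vec; []; _∷_; lookup; _[_]≔_; tabulate; replicate)
open import Data.Vec.Properties using (lookup∘update; lookup∘update′; lookup∘tabulate)
open import Function using (_∘_; id)
open import Function.Definitions using (Injective)
open import Level using (0ℓ)
open import Relation.Binary.Definitions using (tri<; tri≈; tri>)
open import Relation.Binary.PropositionalEquality
  using (_≡_; _≢_; refl; sym; trans; cong; cong₂; subst; subst₂; ≢-sym; module ≡-Reasoning)
open import Relation.Nullary using (¬_; Dec; yes; no; ¬?; _×-dec_; _→-dec_)

-- Finite sums

module Sum (R : CommutativeSemiring 0ℓ 0ℓ) where
  open CommutativeSemiring R hiding (refl; sym; trans) renaming (_+_ to _⊕_; _*_ to _⊗_)
  open CommutativeSemiring R using () renaming (refl to ≈-refl; sym to ≈-sym; trans to ≈-trans)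

  ∑ : {X : Set} → List X → (X → Carrier) → Carrier
  ∑ []       f = 0#
  ∑ (x ∷ xs) f = f x ⊕ ∑ xs f

  module _ {X : Set} where
    ∑-cong : (xs : List X) {f g : X → Carrier} → (∀ x → f x ≈ g x) → ∑ xs f ≈ ∑ xs g
    ∑-cong []       f≈g = ≈-refl
    ∑-cong (x ∷ xs) f≈g = +-cong (f≈g x) (∑-cong xs f≈g)

    ∑-zero : (xs : List X) → ∑ xs (λ _ → 0#) ≈ 0#
    ∑-zero []       = ≈-refl
    ∑-zero (x ∷ xs) = ≈-trans (+-identityˡ _) (∑-zero xs)

    private
      interchange : ∀ a b c d → (a ⊕ b) ⊕ (c ⊕ d) ≈ (a ⊕ c) ⊕ (b ⊕ d)
      interchange a b c d =
        ≈-trans (+-assoc a b _) (≈-trans (+-congˡ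
          (≈-trans (≈-sym (+-assoc b c d)) (≈-trans (+-congʳ (+-comm b c)) (+-assoc c b d))))
          (≈-sym (+-assoc a c _)))

    ∑-distrib-+ : (xs : List X) (f g : X → Carrier) → ∑ xs (λ x → f x ⊕ g x) ≈ ∑ xs f ⊕ ∑ xs g
    ∑-distrib-+ []       f g = ≈-sym (+-identityˡ _)
    ∑-distrib-+ (x ∷ xs) f g =
      ≈-trans (+-congˡ (∑-distrib-+ xs f g)) (interchange (f x) (g x) _ _)

    *-distribˡ-∑ : (xs : List X) (a : Carrier) (f : X → Carrier) → a ⊗ ∑ xs f ≈ ∑ xs (λ x → a ⊗ f x)
    *-distribˡ-∑ []       a f = zeroʳ a
    *-distribˡ-∑ (x ∷ xs) a f = ≈-trans (distribˡ a _ _) (+-congˡ (*-distribˡ-∑ xs a f))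

    *-distribʳ-∑ : (xs : List X) (a : Carrier) (f : X → Carrier) → ∑ xs f ⊗ a ≈ ∑ xs (λ x → f x ⊗ a)
    *-distribʳ-∑ xs a f =
      ≈-trans (*-comm _ a) (≈-trans (*-distribˡ-∑ xs a f) (∑-cong xs λ x → *-comm a (f x)))

    ∑-++ : (xs ys : List X) (f : X → Carrier) → ∑ (xs ++ ys) f ≈ ∑ xs f ⊕ ∑ ys f
    ∑-++ []       ys f = ≈-sym (+-identityˡ _)
    ∑-++ (x ∷ xs) ys f = ≈-trans (+-congˡ (∑-++ xs ys f)) (≈-sym (+-assoc _ _ _))

  ∑-map : {X Y : Set} (xs : List X) (h : X → Y) (f : Y → Carrier) → ∑ (map h xs) f ≈ ∑ xs (f ∘ h)
  ∑-map []       h f = ≈-refl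
  ∑-map (x ∷ xs) h f = +-congˡ (∑-map xs h f)

  ∑-swap : {X Y : Set} (xs : List X) (ys : List Y) (f : X → Y → Carrier) →
           ∑ xs (λ x → ∑ ys (f x)) ≈ ∑ ys (λ y → ∑ xs (λ x → f x y))
  ∑-swap []       ys f = ≈-sym (∑-zero ys)
  ∑-swap (x ∷ xs) ys f =
    ≈-trans (+-congˡ (∑-swap xs ys f)) (≈-sym (∑-distrib-+ ys (f x) _))

  ∑-cartesian : {X Y Z : Set} (h : X → Y → Z) (xs : List X) (ys : List Y) (f : Z → Carrier) →
                ∑ (cartesianProductWith h xs ys) f ≈ ∑ xs (λ x → ∑ ys (λ y → f (h x y)))
  ∑-cartesian h []       ys f = ≈-refl
  ∑-cartesian h (x ∷ xs) ys f =
    ≈-trans (∑-++ (map (h x) ys) _ f) (+-cong (∑-map ys (h x) f) (∑-cartesian h xs ys f))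

  ∑-*-∑ : {X Y : Set} (xs : List X) (ys : List Y) (f : X → Carrier) (g : Y → Carrier) →
          ∑ xs f ⊗ ∑ ys g ≈ ∑ xs (λ x → ∑ ys (λ y → f x ⊗ g y))
  ∑-*-∑ xs ys f g =
    ≈-trans (*-distribʳ-∑ xs _ f) (∑-cong xs λ x → *-distribˡ-∑ ys (f x) g)

-- Uniform tuples and redrawing one coordinate

tuples : ∀ n p → List (Vec (Fin n) p)
tuples n zero    = [ [] ]
tuples n (suc p) = cartesianProductWith _∷_ (allFin n) (tuples n p)

∈-tuples : ∀ {n p} (z : Vec (Fin n) p) → z ∈ tuples n p
∈-tuples []      = here refl
∈-tuples (x ∷ z) = ∈-cartesianProductWith⁺ _∷_ (∈-allFin x) (∈-tuples z)

tuples-nonempty : ∀ n p → .{{NonZero n}} → NonZero (length (tuples n p))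
tuples-nonempty (suc n) p = >-nonZero (∈-length (∈-tuples (replicate p zero)))

module Resample (R : CommutativeSemiring 0ℓ 0ℓ) (n : ℕ) where
  open CommutativeSemiring R using (Carrier; _≈_; setoid) renaming (refl to ≈-refl; sym to ≈-sym; trans to ≈-trans)
  open Sum R
  open import Relation.Binary.Reasoning.Setoid setoid

  -- Redrawing one coordinate of a uniform tuple leaves it uniform. The right side repeats the sum
  -- over `allFin n` in place of a factor n, so that one proof serves both the counts in ℕ and the
  -- covariances in ℤ.
  ∑-resample : ∀ {p} (c : Fin p) (F : Vec (Fin n) p → Carrier) →
               ∑ (tuples n p) (λ z → ∑ (allFin n) (λ u → F (z [ c ]≔ u))) ≈
               ∑ (allFin n) (λ _ → ∑ (tuples n p) F)
  ∑-resample {suc p} zero F = begin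
    ∑ (tuples n (suc p)) (λ z → ∑ (allFin n) (λ u → F (z [ zero ]≔ u)))
      ≈⟨ ∑-cartesian _∷_ (allFin n) (tuples n p) _ ⟩
    ∑ (allFin n) (λ _ → ∑ (tuples n p) (λ z → ∑ (allFin n) (λ u → F (u ∷ z))))
      ≈⟨ ∑-cong (allFin n) (λ _ → ∑-swap (tuples n p) (allFin n) _) ⟩
    ∑ (allFin n) (λ _ → ∑ (allFin n) (λ u → ∑ (tuples n p) (λ z → F (u ∷ z))))
      ≈⟨ ∑-cong (allFin n) (λ _ → ∑-cartesian _∷_ (allFin n) (tuples n p) F) ⟨
    ∑ (allFin n) (λ _ → ∑ (tuples n (suc p)) F) ∎
  ∑-resample {suc p} (suc c) F = begin
    ∑ (tuples n (suc p)) (λ z → ∑ (allFin n) (λ u → F (z [ suc c ]≔ u)))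
      ≈⟨ ∑-cartesian _∷_ (allFin n) (tuples n p) _ ⟩
    ∑ (allFin n) (λ a → ∑ (tuples n p) (λ z → ∑ (allFin n) (λ u → F (a ∷ z [ c ]≔ u))))
      ≈⟨ ∑-cong (allFin n) (λ a → ∑-resample c (λ z → F (a ∷ z))) ⟩
    ∑ (allFin n) (λ a → ∑ (allFin n) (λ _ → ∑ (tuples n p) (λ z → F (a ∷ z))))
      ≈⟨ ∑-swap (allFin n) (allFin n) _ ⟩
    ∑ (allFin n) (λ _ → ∑ (allFin n) (λ a → ∑ (tuples n p) (λ z → F (a ∷ z))))
      ≈⟨ ∑-cong (allFin n) (λ _ → ∑-cartesian _∷_ (allFin n) (tuples n p) F) ⟨
    ∑ (allFin n) (λ _ → ∑ (tuples n (suc p)) F) ∎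

-- Inequalities for finite sums

open import Data.Nat.Properties
open Sum +-*-commutativeSemiring
module ℤΣ = Sum ℤ.+-*-commutativeSemiring
open Resample +-*-commutativeSemiring using (∑-resample)

2*m*n≤m*m+n*n : ∀ m n → 2 * (m * n) ≤ m * m + n * n
2*m*n≤m*m+n*n m n with ≤-total m n
... | inj₁ m≤n with d , refl ← m≤n⇒∃[o]m+o≡n m≤n = subst (2 * (m * (m + d)) ≤_) (sym (eq m d)) (m≤m+n _ (d * d))
  where
  eq : ∀ m d → m * m + (m + d) * (m + d) ≡ 2 * (m * (m + d)) + d * d
  eq = solve-∀
2*m*n≤m*m+n*n m n | inj₂ n≤m with d , refl ← m≤n⇒∃[o]m+o≡n n≤m = subst (2 * ((n + d) * n) ≤_) (sym (eq n d)) (m≤m+n _ (d * d))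
  where
  eq : ∀ n d → (n + d) * (n + d) + n * n ≡ 2 * ((n + d) * n) + d * d
  eq = solve-∀

module _ {X : Set} where
  ∑-mono : (xs : List X) {f g : X → ℕ} → (∀ x → f x ≤ g x) → ∑ xs f ≤ ∑ xs g
  ∑-mono []       f≤g = z≤n
  ∑-mono (x ∷ xs) f≤g = +-mono-≤ (f≤g x) (∑-mono xs f≤g)

  ∑-const : (xs : List X) (c : ℕ) → ∑ xs (λ _ → c) ≡ length xs * c
  ∑-const []       c = refl
  ∑-const (x ∷ xs) c = cong (_+_ c) (∑-const xs c)

  ∑-≥ : {xs : List X} {x : X} → x ∈ xs → (f : X → ℕ) → f x ≤ ∑ xs f
  ∑-≥ (here refl) f = m≤m+n _ _
  ∑-≥ (there {x = y} x∈) f = ≤-trans (∑-≥ x∈ f) (m≤n+m _ (f y))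

  ∑-<⇒∃< : (xs : List X) {f g : X → ℕ} → ∑ xs f < ∑ xs g → ∃ λ x → f x < g x
  ∑-<⇒∃< (x ∷ xs) {f} {g} lt with g x ≤? f x
  ... | no g≰f  = x , ≰⇒> g≰f
  ... | yes g≤f = ∑-<⇒∃< xs (+-cancelˡ-< (f x) _ _ (≤-trans lt (+-monoˡ-≤ _ g≤f)))

  sum-map : (xs : List X) (f : X → ℕ) → sum (map f xs) ≡ ∑ xs f
  sum-map []       f = refl
  sum-map (x ∷ xs) f = cong (_+_ (f x)) (sum-map xs f)

  -- Written as a double sum, the square is bounded term by term by `2*m*n≤m*m+n*n`; each of the two
  -- resulting square terms sums to `length xs * S`.
  cauchy-schwarz : (xs : List X) (f : X → ℕ) → ∑ xs f * ∑ xs f ≤ length xs * ∑ xs (λ x → f x * f x)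
  cauchy-schwarz xs f = *-cancelˡ-≤ 2 (begin
    2 * (∑ xs f * ∑ xs f)
      ≡⟨ cong (2 *_) (∑-*-∑ xs xs f f) ⟩
    2 * ∑ xs (λ x → ∑ xs (λ y → f x * f y))
      ≡⟨ trans (*-distribˡ-∑ xs 2 _) (∑-cong xs λ x → *-distribˡ-∑ xs 2 _) ⟩
    ∑ xs (λ x → ∑ xs (λ y → 2 * (f x * f y)))
      ≤⟨ ∑-mono xs (λ x → ∑-mono xs λ y → 2*m*n≤m*m+n*n (f x) (f y)) ⟩
    ∑ xs (λ x → ∑ xs (λ y → f x * f x + f y * f y))
      ≡⟨ trans (∑-cong xs λ x → ∑-distrib-+ xs _ _) (∑-distrib-+ xs _ _) ⟩
    ∑ xs (λ x → ∑ xs (λ _ → f x * f x)) + ∑ xs (λ _ → ∑ xs (λ y → f y * f y))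
      ≡⟨ cong (_+ ∑ xs (λ _ → S)) (∑-swap xs xs (λ x _ → f x * f x)) ⟩
    ∑ xs (λ _ → S) + ∑ xs (λ _ → S)
      ≡⟨ cong₂ _+_ (∑-const xs S) (∑-const xs S) ⟩
    length xs * S + length xs * S
      ≡⟨ cong (_+_ (length xs * S)) (+-identityʳ (length xs * S)) ⟨
    2 * (length xs * S) ∎)
    where
    open ≤-Reasoning
    S = ∑ xs (λ x → f x * f x)

  ∑ℤ-mono : (xs : List X) {f g : X → ℤ} → (∀ x → f x ℤ.≤ g x) → ℤΣ.∑ xs f ℤ.≤ ℤΣ.∑ xs g
  ∑ℤ-mono []       f≤g = ℤ.≤-refl
  ∑ℤ-mono (x ∷ xs) f≤g = ℤ.+-mono-≤ (f≤g x) (∑ℤ-mono xs f≤g)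

  ∑ℤ-pos : (xs : List X) (f : X → ℕ) → ℤΣ.∑ xs (λ x → + f x) ≡ + ∑ xs f
  ∑ℤ-pos []       f = refl
  ∑ℤ-pos (x ∷ xs) f = trans (cong (ℤ._+_ (+ f x)) (∑ℤ-pos xs f)) (sym (ℤ.pos-+ (f x) (∑ xs f)))

  ∑ℤ-const : (xs : List X) (c : ℤ) → ℤΣ.∑ xs (λ _ → c) ≡ + length xs ℤ.* c
  ∑ℤ-const []       c = sym (ℤ.*-zeroˡ c)
  ∑ℤ-const (x ∷ xs) c = trans (cong (ℤ._+_ c) (∑ℤ-const xs c)) (sym (ℤ.suc-* (+ length xs) c))

length-allFin : ∀ n → length (allFin n) ≡ n
length-allFin n = length-tabulate {n = n} id

∑-allFin-const : ∀ n c → ∑ (allFin n) (λ _ → c) ≡ n * c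
∑-allFin-const n c = trans (∑-const (allFin n) c) (cong (_* c) (length-allFin n))

-- Indicators and the probability of a collision

indicator : {P : Set} → Dec P → ℕ
indicator (yes _) = 1
indicator (no _)  = 0

indicator-mono : {P Q : Set} (P? : Dec P) (Q? : Dec Q) → (P → Q) → indicator P? ≤ indicator Q?
indicator-mono (yes p) (yes q) f = ≤-refl
indicator-mono (yes p) (no ¬q) f = ⊥-elim (¬q (f p))
indicator-mono (no ¬p) Q?      f = z≤n

indicator-*-mono : {P Q S : Set} (P? : Dec P) (Q? : Dec Q) (S? : Dec S) → (P → Q → S) →
                   indicator P? * indicator Q? ≤ indicator S?
indicator-*-mono (yes p) (yes q) (yes s) f = ≤-refl
indicator-*-mono (yes p) (yes q) (no ¬s) f = ⊥-elim (¬s (f p q))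
indicator-*-mono (yes p) (no ¬q) S? f = z≤n
indicator-*-mono (no ¬p) Q?      S? f = z≤n

indicator≡1 : {P : Set} (P? : Dec P) → P → indicator P? ≡ 1
indicator≡1 (yes _) p = refl
indicator≡1 (no ¬p) p = ⊥-elim (¬p p)

indicator≤1 : {P : Set} (P? : Dec P) → indicator P? ≤ 1
indicator≤1 (yes _) = ≤-refl
indicator≤1 (no _)  = z≤n

-- Stated for an injective `f` because the tail of `tabulate f` is `tabulate (f ∘ suc)`; the
-- instance wanted is `f = id`.
∑-tabulate-indicator-≟ : ∀ {m n} (f : Fin m → Fin n) → (∀ {i j} → f i ≡ f j → i ≡ j) → (v : Fin n) →
                         ∑ (List.tabulate f) (λ u → indicator (u Fin.≟ v)) ≤ 1
∑-tabulate-indicator-≟ {zero}  f inj v = z≤n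
∑-tabulate-indicator-≟ {suc m} f inj v with f zero Fin.≟ v
... | no _ = ∑-tabulate-indicator-≟ (f ∘ suc) (λ eq → Fin.suc-injective (inj eq)) v
... | yes refl = ≤-reflexive (cong suc (vanish (f ∘ suc) (λ i eq → Fin.0≢1+n (sym (inj eq)))))
  where
  vanish : ∀ {m} (g : Fin m → Fin _) → (∀ i → g i ≢ f zero) →
           ∑ (List.tabulate g) (λ u → indicator (u Fin.≟ f zero)) ≡ 0
  vanish {zero}  g g≢ = refl
  vanish {suc m} g g≢ with g zero Fin.≟ f zero
  ... | yes eq = ⊥-elim (g≢ zero eq)
  ... | no _   = vanish (g ∘ suc) (g≢ ∘ suc)

∑-indicator-≟ : ∀ {n} (v : Fin n) → ∑ (allFin n) (λ u → indicator (u Fin.≟ v)) ≤ 1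
∑-indicator-≟ = ∑-tabulate-indicator-≟ id id

n*∑-resample : ∀ {n p} (c : Fin p) (F : Vec (Fin n) p → ℕ) →
               n * ∑ (tuples n p) F ≡ ∑ (tuples n p) (λ z → ∑ (allFin n) (λ u → F (z [ c ]≔ u)))
n*∑-resample {n} c F = trans (sym (∑-allFin-const n _)) (sym (∑-resample n c F))

n*∑ℤ-resample : ∀ {n p} (c : Fin p) (F : Vec (Fin n) p → ℤ) →
                + n ℤ.* ℤΣ.∑ (tuples n p) F ≡
                ℤΣ.∑ (tuples n p) (λ z → ℤΣ.∑ (allFin n) (λ u → F (z [ c ]≔ u)))
n*∑ℤ-resample {n} {p} c F =
  trans (cong (λ k → + k ℤ.* ℤΣ.∑ (tuples n p) F) (sym (length-allFin n)))
  (trans (sym (∑ℤ-const (allFin n) _)) (sym (Resample.∑-resample ℤ.+-*-commutativeSemiring n c F)))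

-- The collision probability is at most 1/n: when coordinate `c` is redrawn, at most one of its n
-- values agrees with coordinate `d`.
n*∑-collision : ∀ {n p} {c d : Fin p} → c ≢ d →
                n * ∑ (tuples n p) (λ z → indicator (lookup z c Fin.≟ lookup z d)) ≤ length (tuples n p)
n*∑-collision {n} {p} {c} {d} c≢d = begin
  n * ∑ (tuples n p) F
    ≡⟨ n*∑-resample c F ⟩
  ∑ (tuples n p) (λ z → ∑ (allFin n) (λ u → F (z [ c ]≔ u)))
    ≡⟨ ∑-cong (tuples n p) (λ z → ∑-cong (allFin n) λ u → cong₂ (λ a b → indicator (a Fin.≟ b))
         (lookup∘update c z u) (lookup∘update′ (c≢d ∘ sym) z u)) ⟩
  ∑ (tuples n p) (λ z → ∑ (allFin n) (λ u → indicator (u Fin.≟ lookup z d)))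
    ≤⟨ ∑-mono (tuples n p) (λ z → ∑-indicator-≟ (lookup z d)) ⟩
  ∑ (tuples n p) (λ _ → 1)                                  ≡⟨ ∑-const (tuples n p) 1 ⟩
  length (tuples n p) * 1                                   ≡⟨ *-identityʳ _ ⟩
  length (tuples n p) ∎
  where
  open ≤-Reasoning
  F : Vec (Fin n) p → ℕ
  F z = indicator (lookup z c Fin.≟ lookup z d)

-- Counting homomorphisms

module Homs {n h e : ℕ} (endpoints : Fin e → Fin h × Fin h) (A : Fin e → SimpleGraph n) where

  Hom : (Fin h → Fin n) → Set
  Hom y = ∀ i → adj (A i) (y (proj₁ (endpoints i))) (y (proj₂ (endpoints i))) ≡ true

  Hom? : ∀ y → Dec (Hom y)
  Hom? y = Fin.all? λ i → adj (A i) _ _ Bool.≟ true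

  Hom-resp : ∀ {y y′} → (∀ b → y b ≡ y′ b) → Hom y → Hom y′
  Hom-resp y≗y′ hom i = subst₂ (λ a b → adj (A i) a b ≡ true) (y≗y′ _) (y≗y′ _) (hom i)

  no-loop : ∀ i {a b} → a ≡ b → adj (A i) a b ≢ true
  no-loop i {a} refl eq with trans (sym eq) (adj-irrefl (A i) a)
  ... | ()

  -- Divided by n^p, this is the probability that a uniform `z` makes `z ∘ g` a homomorphism.
  -- Vertices with the same `g` are forced to share a random value.
  homs : ∀ {p} → (Fin h → Fin p) → ℕ
  homs {p} g = ∑ (tuples n p) (λ z → indicator (Hom? (lookup z ∘ g)))

  homs-resp : ∀ {p} {g g′ : Fin h → Fin p} → (∀ b → g b ≡ g′ b) → homs g ≤ homs g′
  homs-resp {p} {g} {g′} g≗g′ = ∑-mono (tuples n p) λ z →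
    indicator-mono (Hom? (lookup z ∘ g)) (Hom? (lookup z ∘ g′)) (Hom-resp λ b → cong (lookup z) (g≗g′ b))

  -- One split: `a` leaves the coordinate `j`, which it may share with other vertices, for a
  -- coordinate `q` that no vertex uses under `g`.
  module _ {p} {g g′ : Fin h → Fin p} {a : Fin h} (fresh : ∀ b → g b ≢ g′ a)
           (agree : ∀ {b} → b ≢ a → g′ b ≡ g b) where

    private
      j q : Fin p
      j = g a
      q = g′ a

      Old New : Vec (Fin n) p → Set
      Old z = Hom (lookup z ∘ g)
      New z = Hom (lookup z ∘ g′)

      old? : ∀ z → Dec (Old z)
      old? z = Hom? (lookup z ∘ g)
      new? : ∀ z → Dec (New z)
      new? z = Hom? (lookup z ∘ g′)

      module _ (z : Vec (Fin n) p) (u w : Fin n) where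
        z′ : Vec (Fin n) p
        z′ = (z [ j ]≔ u) [ q ]≔ w

        at-a : lookup z′ (g′ a) ≡ lookup (z [ j ]≔ w) (g a)
        at-a = trans (lookup∘update q (z [ j ]≔ u) w) (sym (lookup∘update j z w))

        off-a : ∀ {b} → b ≢ a → lookup z′ (g′ b) ≡ lookup (z [ j ]≔ u) (g b)
        off-a {b} b≢a = trans (cong (lookup z′) (agree b≢a))
                              (lookup∘update′ (fresh b) (z [ j ]≔ u) w)

        off-j : ∀ {b} → b ≢ a → g b ≢ j → lookup z′ (g′ b) ≡ lookup (z [ j ]≔ w) (g b)
        off-j b≢a gb≢j = trans (off-a b≢a)
          (trans (lookup∘update′ gb≢j z u) (sym (lookup∘update′ gb≢j z w)))

        -- An edge at a sees the copy w of vertex j only, every other edge the copy u only; an edge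
        -- between two preimages of j would have been a loop.
        glue : Old (z [ j ]≔ u) → Old (z [ j ]≔ w) → New z′
        glue old-u old-w i with proj₁ (endpoints i) Fin.≟ a | proj₂ (endpoints i) Fin.≟ a
        ... | no b≢a | no c≢a =
          subst₂ (λ x y → adj (A i) x y ≡ true) (sym (off-a b≢a)) (sym (off-a c≢a)) (old-u i)
        ... | yes b≡a | yes c≡a =
          ⊥-elim (no-loop i (cong (lookup (z [ j ]≔ u) ∘ g) (trans b≡a (sym c≡a))) (old-u i))
        ... | yes b≡a | no c≢a with g (proj₂ (endpoints i)) Fin.≟ j
        ...   | yes gc≡j =
          ⊥-elim (no-loop i (cong (lookup (z [ j ]≔ u)) (trans (cong g b≡a) (sym gc≡j))) (old-u i))
        ...   | no gc≢j =
          subst₂ (λ x y → adj (A i) x y ≡ true)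
            (trans (cong (lookup (z [ j ]≔ w) ∘ g) b≡a) (trans (sym at-a) (cong (lookup z′ ∘ g′) (sym b≡a))))
            (sym (off-j c≢a gc≢j)) (old-w i)
        glue old-u old-w i | no b≢a | yes c≡a with g (proj₁ (endpoints i)) Fin.≟ j
        ...   | yes gb≡j =
          ⊥-elim (no-loop i (cong (lookup (z [ j ]≔ u)) (trans gb≡j (sym (cong g c≡a)))) (old-u i))
        ...   | no gb≢j =
          subst₂ (λ x y → adj (A i) x y ≡ true)
            (sym (off-j b≢a gb≢j))
            (trans (cong (lookup (z [ j ]≔ w) ∘ g) c≡a) (trans (sym at-a) (cong (lookup z′ ∘ g′) (sym c≡a))))
            (old-w i)

    -- Cauchy–Schwarz over the coordinate g a.
    homs-split : .{{NonZero n}} → homs g * homs g ≤ length (tuples n p) * homs g′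
    homs-split = *-cancelˡ-≤ n (*-cancelˡ-≤ n (begin
      -- Redrawing `j` in each factor brings in n² on the left; undoing the redraws of `q` and `j`
      -- brings in n² on the right, so both cancel.
      n * (n * (homs g * homs g))
        ≡⟨ eq₁ n (homs g) ⟩
      (n * homs g) * (n * homs g)
        ≡⟨ cong₂ _*_ (n*∑-resample j (indicator ∘ old?)) (n*∑-resample j (indicator ∘ old?)) ⟩
      ∑ Z D * ∑ Z D
        ≤⟨ cauchy-schwarz Z D ⟩
      length Z * ∑ Z (λ z → D z * D z)
        ≤⟨ *-monoʳ-≤ (length Z) (∑-mono Z D*D≤) ⟩
      length Z * ∑ Z (λ z → ∑ (allFin n) (λ u → K (z [ j ]≔ u)))
        ≡⟨ cong (length Z *_) (trans (sym (n*∑-resample j K)) (cong (n *_) (sym (n*∑-resample q (indicator ∘ new?))))) ⟩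
      length Z * (n * (n * homs g′))
        ≡⟨ eq₂ n (length Z) (homs g′) ⟩
      n * (n * (length Z * homs g′)) ∎))
      where
      open ≤-Reasoning
      Z = tuples n p
      D K : Vec (Fin n) p → ℕ
      D z = ∑ (allFin n) (λ u → indicator (old? (z [ j ]≔ u)))
      K z = ∑ (allFin n) (λ w → indicator (new? (z [ q ]≔ w)))
      D*D≤ : ∀ z → D z * D z ≤ ∑ (allFin n) (λ u → K (z [ j ]≔ u))
      D*D≤ z = ≤-trans (≤-reflexive (∑-*-∑ (allFin n) (allFin n) _ _))
        (∑-mono (allFin n) λ u → ∑-mono (allFin n) λ w →
          indicator-*-mono (old? (z [ j ]≔ u)) (old? (z [ j ]≔ w)) (new? (z′ z u w)) (glue z u w))
      eq₁ : ∀ n x → n * (n * (x * x)) ≡ (n * x) * (n * x)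
      eq₁ = solve-∀
      eq₂ : ∀ n x y → x * (n * (n * y)) ≡ n * (n * (x * y))
      eq₂ = solve-∀

  -- A union bound: without an injective homomorphism, every `z` that is counted gives the same
  -- value to two distinct vertices. There are at most h² pairs, and each collides with probability
  -- at most 1/n because `g` separates them.
  homs-injective : ∀ {p} {g : Fin h → Fin p} → Injective _≡_ _≡_ g →
                   (∀ y → Injective _≡_ _≡_ y → ¬ Hom y) →
                   n * homs g ≤ h * (h * length (tuples n p))
  homs-injective {p} {g} g-inj none = begin
    n * homs g
      ≤⟨ *-monoʳ-≤ n (∑-mono Z hom⇒collision) ⟩
    n * ∑ Z (λ z → ∑ V (λ b → ∑ V (λ c → collision b c z)))
      ≡⟨ cong (n *_) (trans (∑-swap Z V _) (∑-cong V λ b → ∑-swap Z V _)) ⟩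
    n * ∑ V (λ b → ∑ V (λ c → ∑ Z (collision b c)))
      ≡⟨ trans (*-distribˡ-∑ V n _) (∑-cong V λ b → *-distribˡ-∑ V n _) ⟩
    ∑ V (λ b → ∑ V (λ c → n * ∑ Z (collision b c)))
      ≤⟨ ∑-mono V (λ b → ∑-mono V λ c → few b c) ⟩
    ∑ V (λ b → ∑ V (λ c → length Z))
      ≡⟨ trans (∑-cong V λ b → ∑-allFin-const h _) (∑-allFin-const h _) ⟩
    h * (h * length Z) ∎
    where
    open ≤-Reasoning
    Z = tuples n p
    V = allFin h
    -- The condition `b ≢ c` removes the diagonal pairs, which would collide for every `z`.
    collision? : ∀ b c (z : Vec (Fin n) p) → Dec (b ≢ c × lookup z (g b) ≡ lookup z (g c))
    collision? b c z = ¬? (b Fin.≟ c) ×-dec (lookup z (g b) Fin.≟ lookup z (g c))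
    collision : Fin h → Fin h → Vec (Fin n) p → ℕ
    collision b c z = indicator (collision? b c z)
    few : ∀ b c → n * ∑ Z (collision b c) ≤ length Z
    few b c with b Fin.≟ c
    ... | yes b≡c = ≤-trans (≤-reflexive (trans (cong (n *_) (∑-zero Z)) (*-zeroʳ n))) z≤n
    ... | no b≢c = ≤-trans
      (*-monoʳ-≤ n (∑-mono Z λ z →
        let same? = lookup z (g b) Fin.≟ lookup z (g c)
        in indicator-mono (yes b≢c ×-dec same?) same? proj₂))
      (n*∑-collision (b≢c ∘ g-inj))
    hom⇒collision : ∀ z → indicator (Hom? (lookup z ∘ g)) ≤ ∑ V (λ b → ∑ V (λ c → collision b c z))
    hom⇒collision z with Hom? (lookup z ∘ g)
    ... | no _ = z≤n
    ... | yes hom with 1 ≤? ∑ V (λ b → ∑ V (λ c → collision b c z))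
    ...   | yes 1≤ = 1≤
    ...   | no 1≰ = ⊥-elim (none (lookup z ∘ g) injective hom)
      where
      injective : Injective _≡_ _≡_ (lookup z ∘ g)
      injective {b} {c} eq with b Fin.≟ c
      ... | yes b≡c = b≡c
      ... | no b≢c = ⊥-elim (1≰ (begin
        1                                         ≡⟨ indicator≡1 (collision? b c z) (b≢c , eq) ⟨
        collision b c z                           ≤⟨ ∑-≥ (∈-allFin c) (λ c → collision b c z) ⟩
        ∑ V (λ c → collision b c z)               ≤⟨ ∑-≥ (∈-allFin b) (λ b → ∑ V (λ c → collision b c z)) ⟩
        ∑ V (λ b → ∑ V (λ c → collision b c z)) ∎))

  -- Splitting all vertices apart

  module _ {s} (g : Fin h → Fin s) where
    -- Vertices below i own a private coordinate among the last h; the others still share coordinates via g.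
    stage : ℕ → Fin h → Fin (s + h)
    stage i b with toℕ b <? i
    ... | yes _ = s ↑ʳ b
    ... | no _  = g b ↑ˡ h

    private
      ↑ˡ≢↑ʳ : ∀ {m n} (x : Fin m) (y : Fin n) → x ↑ˡ n ≢ m ↑ʳ y
      ↑ˡ≢↑ʳ {suc m} zero    y ()
      ↑ˡ≢↑ʳ {suc m} (suc x) y eq = ↑ˡ≢↑ʳ x y (Fin.suc-injective eq)

      stage-below : ∀ {i b} → toℕ b < i → stage i b ≡ s ↑ʳ b
      stage-below {i} {b} b<i with toℕ b <? i
      ... | yes _   = refl
      ... | no b≮i  = ⊥-elim (b≮i b<i)

      stage-above : ∀ {i b} → ¬ toℕ b < i → stage i b ≡ g b ↑ˡ h
      stage-above {i} {b} b≮i with toℕ b <? i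
      ... | yes b<i = ⊥-elim (b≮i b<i)
      ... | no _    = refl

      -- Together with `stage-agree`, this makes the passage to the next stage a single split:
      -- private coordinates so far belong to vertices below `a`, and shared coordinates lie among
      -- the first s.
      stage-fresh : ∀ a b → stage (toℕ a) b ≢ stage (suc (toℕ a)) a
      stage-fresh a b eq with toℕ b <? toℕ a | trans eq (stage-below {suc (toℕ a)} {a} ≤-refl)
      ... | yes b<a | eq′ = <-irrefl (cong toℕ (Fin.↑ʳ-injective s b a eq′)) b<a
      ... | no _    | eq′ = ↑ˡ≢↑ʳ (g b) a eq′

      stage-agree : ∀ a {b} → b ≢ a → stage (suc (toℕ a)) b ≡ stage (toℕ a) b
      stage-agree a {b} b≢a with toℕ b <? toℕ a
      ... | yes b<a = stage-below (m<n⇒m<1+n b<a)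
      ... | no b≮a  = stage-above λ b<1+a → b≮a (≤∧≢⇒< (≤-pred b<1+a) (b≢a ∘ Fin.toℕ-injective))

    -- Here 1/c is a lower bound for the initial density. Each split squares the lower bound, hence
    -- the exponent 2^i after i splits.
    homs-stages : .{{_ : NonZero n}} → ∀ c i → i ≤ h → length (tuples n (s + h)) ≤ c * homs (stage 0) →
                  length (tuples n (s + h)) ≤ c ^ (2 ^ i) * homs (stage i)
    homs-stages c zero    i≤h N≤ = subst (λ c → _ ≤ c * homs (stage 0)) (sym (^-identityʳ c)) N≤
    homs-stages c (suc i) i<h N≤ = *-cancelˡ-≤ N {{tuples-nonempty n (s + h)}} (begin
      N * N                         ≤⟨ *-mono-≤ IH IH ⟩
      (d * x) * (d * x)             ≡⟨ eq₁ d x ⟩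
      (d * d) * (x * x)             ≤⟨ *-monoʳ-≤ (d * d) split ⟩
      (d * d) * (N * y)             ≡⟨ eq₂ (d * d) N y ⟩
      N * ((d * d) * y)             ≡⟨ cong (λ k → N * (k * y)) (^-distribˡ-+-* c (2 ^ i) (2 ^ i)) ⟨
      N * (c ^ (2 ^ i + 2 ^ i) * y) ≡⟨ cong (λ k → N * (c ^ (2 ^ i + k) * y)) (+-identityʳ (2 ^ i)) ⟨
      N * (c ^ (2 ^ suc i) * y)     ∎)
      where
      open ≤-Reasoning
      N = length (tuples n (s + h))
      d = c ^ (2 ^ i)
      x = homs (stage i)
      y = homs (stage (suc i))
      IH : N ≤ d * x
      IH = homs-stages c i (<⇒≤ i<h) N≤
      -- The vertex with number i is the one that receives its private coordinate in this step.
      a : Fin h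
      a = fromℕ< i<h
      split : x * x ≤ N * y
      split = subst (λ i → homs (stage i) * homs (stage i) ≤ N * homs (stage (suc i)))
        (Fin.toℕ-fromℕ< i<h)
        (homs-split {g = stage (toℕ a)} {stage (suc (toℕ a))} {a} (stage-fresh a) (stage-agree a))
      eq₁ : ∀ d x → (d * x) * (d * x) ≡ (d * d) * (x * x)
      eq₁ = solve-∀
      eq₂ : ∀ d N y → d * (N * y) ≡ N * (d * y)
      eq₂ = solve-∀

    -- Otherwise the density is at least 1/c, and after h splits it is still at least 1/c^(2^h). All
    -- vertices then have private coordinates, so `homs-injective` bounds it by h²/n, which is
    -- smaller for n this large.
    homs-few : ∀ c → c ^ (2 ^ h) * (h * h) < n → (∀ y → Injective _≡_ _≡_ y → ¬ Hom y) →
               c * homs (λ b → g b ↑ˡ h) ≤ length (tuples n (s + h))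
    homs-few c n-large none with ≤-total (c * homs (stage 0)) (length (tuples n (s + h)))
    ... | inj₁ few  = ≤-trans (*-monoʳ-≤ c (homs-resp λ b → sym (stage-above {0} {b} λ ()))) few
    ... | inj₂ many = ⊥-elim (<⇒≱ n-large (*-cancelʳ-≤ n _ N {{tuples-nonempty n (s + h)}} (begin
      n * N                   ≤⟨ *-monoʳ-≤ n (homs-stages c h ≤-refl many) ⟩
      n * (d * x)             ≡⟨ eq₁ n d x ⟩
      d * (n * x)             ≤⟨ *-monoʳ-≤ d (homs-injective stage-injective none) ⟩
      d * (h * (h * N))       ≡⟨ eq₂ d h N ⟩
      d * (h * h) * N         ∎)))
      where
      open ≤-Reasoning
      instance
        n≢0 : NonZero n
        n≢0 = >-nonZero (≤-trans (s≤s z≤n) n-large)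
      N = length (tuples n (s + h))
      d = c ^ (2 ^ h)
      x = homs (stage h)
      stage-injective : Injective _≡_ _≡_ (stage h)
      stage-injective {b} {c} eq = Fin.↑ʳ-injective s b c
        (trans (sym (stage-below (Fin.toℕ<n b))) (trans eq (stage-below (Fin.toℕ<n c))))
      eq₁ : ∀ n d x → n * (d * x) ≡ d * (n * x)
      eq₁ = solve-∀
      eq₂ : ∀ d h N → d * (h * (h * N)) ≡ d * (h * h) * N
      eq₂ = solve-∀

-- The second moment of a sampled sum

i≤+∣i∣ : ∀ i → i ℤ.≤ + ∣ i ∣
i≤+∣i∣ (+ n)      = ℤ.≤-refl
i≤+∣i∣ ℤ.-[1+ n ] = ℤ.-≤+

+∣i∣*∣i∣ : ∀ i → + (∣ i ∣ * ∣ i ∣) ≡ i ℤ.* i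
+∣i∣*∣i∣ (+ n)      = ℤ.pos-* n n
+∣i∣*∣i∣ ℤ.-[1+ n ] = refl

allPairs : ∀ m → List (Fin m × Fin m)
allPairs m = cartesianProduct (allFin m) (allFin m)

module _ {m p : ℕ} (π : Fin m → Fin p) where

  private
    Pair : Set
    Pair = Fin m × Fin m

    pairs : List Pair
    pairs = allPairs m

    c : Fin m → Fin m → ℕ
    c u v = indicator (π u Fin.≟ π v)

  -- Ordered pairs are counted with the diagonal included, so the least possible value m is attained
  -- exactly by injective `π`.
  collisions : ℕ
  collisions = ∑ (allFin m) (λ u → ∑ (allFin m) (λ v → c u v))

  private
    ∑∑ : (Fin m → Fin m → ℕ) → ℕ
    ∑∑ f = ∑ (allFin m) (λ u → ∑ (allFin m) (f u))

    ∑∑-+ : ∀ f g → ∑∑ (λ u v → f u v + g u v) ≡ ∑∑ f + ∑∑ g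
    ∑∑-+ f g = trans (∑-cong (allFin m) λ u → ∑-distrib-+ (allFin m) _ _) (∑-distrib-+ (allFin m) _ _)

    ∑∑-left : ∀ r → ∑∑ (λ u _ → r u) ≡ m * ∑ (allFin m) r
    ∑∑-left r = trans (∑-swap (allFin m) (allFin m) _) (∑-allFin-const m _)

    ∑∑-right : ∀ r → ∑∑ (λ _ v → r v) ≡ m * ∑ (allFin m) r
    ∑∑-right r = ∑-allFin-const m _

    ∑∑-const : ∀ k → ∑∑ (λ _ _ → k) ≡ m * (m * k)
    ∑∑-const k = trans (∑∑-right (λ _ → k)) (cong (m *_) (∑-allFin-const m k))

  -- Nonzero unless the coordinates π w and π q are distinct and independent of those of (u , v).
  overlaps : Pair → Pair → ℕ
  overlaps (u , v) (w , q) = c w u + c w v + (c q u + c q v) + c w q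

  private
    -- The size of the fibre of `π` through `u`.
    r : Fin m → ℕ
    r u = ∑ (allFin m) (λ w → c w u)

    ∑-r : ∑ (allFin m) r ≡ collisions
    ∑-r = ∑-swap (allFin m) (allFin m) _

    ∑-overlaps-inner : ∀ u v → ∑ pairs (overlaps (u , v)) ≡ m * r u + m * r v + (m * r u + m * r v) + collisions
    ∑-overlaps-inner u v = trans (∑-cartesian _,_ (allFin m) (allFin m) _)
      (trans (∑∑-+ _ _) (cong (_+ collisions)
        (trans (∑∑-+ _ _) (cong₂ _+_
          (trans (∑∑-+ _ _) (cong₂ _+_ (∑∑-left _) (∑∑-left _)))
          (trans (∑∑-+ _ _) (cong₂ _+_ (∑∑-right _) (∑∑-right _)))))))

  -- In each of the five coincidences two of the four indices are tied by a collision and the other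
  -- two are free, which gives m² times `collisions`.
  ∑-overlaps : ∑ pairs (λ i → ∑ pairs (overlaps i)) ≡ 5 * (m * m * collisions)
  ∑-overlaps = begin
    ∑ pairs (λ i → ∑ pairs (overlaps i))
      ≡⟨ ∑-cartesian _,_ (allFin m) (allFin m) _ ⟩
    ∑∑ (λ u v → ∑ pairs (overlaps (u , v)))
      ≡⟨ ∑-cong (allFin m) (λ u → ∑-cong (allFin m) (∑-overlaps-inner u)) ⟩
    ∑∑ (λ u v → m * r u + m * r v + (m * r u + m * r v) + collisions)
      ≡⟨ trans (∑∑-+ _ _) (cong₂ _+_ (trans (∑∑-+ _ _) (cong₂ _+_ half half)) (∑∑-const _)) ⟩
    m * (m * collisions) + m * (m * collisions) + (m * (m * collisions) + m * (m * collisions)) + m * (m * collisions)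
      ≡⟨ eq m collisions ⟩
    5 * (m * m * collisions) ∎
    where
    open ≡-Reasoning
    m*∑r : ∑ (allFin m) (λ u → m * r u) ≡ m * collisions
    m*∑r = trans (sym (*-distribˡ-∑ (allFin m) m r)) (cong (m *_) ∑-r)
    half : ∑∑ (λ u v → m * r u + m * r v) ≡ m * (m * collisions) + m * (m * collisions)
    half = trans (∑∑-+ _ _) (cong₂ _+_ (trans (∑∑-left _) (cong (m *_) m*∑r)) (trans (∑∑-right _) (cong (m *_) m*∑r)))
    eq : ∀ m c → m * (m * c) + m * (m * c) + (m * (m * c) + m * (m * c)) + m * (m * c) ≡ 5 * (m * m * c)
    eq = solve-∀

  -- `pulledBack z` sums a kernel of mean zero over the pairs of sampled coordinates. The order of
  -- summation in `centred` is the one in which `cov≡0` redraws them.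
  module SecondMoment {n B : ℕ} .{{_ : NonZero n}} (f : Fin n → Fin n → ℤ) (bounded : ∀ a b → ∣ f a b ∣ ≤ B)
                      (centred : ℤΣ.∑ (allFin n) (λ b → ℤΣ.∑ (allFin n) (λ a → f a b)) ≡ 0ℤ) where

    private
      Z = tuples n p
      N = length Z

      φ : Pair → Vec (Fin n) p → ℤ
      φ (u , v) z = f (lookup z (π u)) (lookup z (π v))

    pulledBack : Vec (Fin n) p → ℤ
    pulledBack z = ℤΣ.∑ pairs (λ i → φ i z)

    private
      cov : Pair → Pair → ℤ
      cov i j = ℤΣ.∑ Z (λ z → φ i z ℤ.* φ j z)

      -- Redrawing the coordinates `π w` and `π q` leaves the factor of (u , v) alone, while the
      -- other factor runs through all values `f a b`, whose sum is zero.
      cov≡0 : ∀ u v w q → π w ≢ π u → π w ≢ π v → π q ≢ π u → π q ≢ π v → π w ≢ π q →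
              cov (u , v) (w , q) ≡ 0ℤ
      cov≡0 u v w q wu wv qu qv wq = cancel (cancel (begin
        + n ℤ.* (+ n ℤ.* ℤΣ.∑ Z G)
          ≡⟨ cong (+ n ℤ.*_) (n*∑ℤ-resample (π w) G) ⟩
        + n ℤ.* ℤΣ.∑ Z (λ z → ℤΣ.∑ (allFin n) (λ a → G (z [ π w ]≔ a)))
          ≡⟨ n*∑ℤ-resample (π q) _ ⟩
        ℤΣ.∑ Z (λ z → ℤΣ.∑ (allFin n) (λ b → ℤΣ.∑ (allFin n) (λ a → G ((z [ π q ]≔ b) [ π w ]≔ a))))
          ≡⟨ ℤΣ.∑-cong Z (λ z → ℤΣ.∑-cong (allFin n) λ b → ℤΣ.∑-cong (allFin n) λ a → fresh z a b) ⟩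
        ℤΣ.∑ Z (λ z → ℤΣ.∑ (allFin n) (λ b → ℤΣ.∑ (allFin n) (λ a → φ (u , v) z ℤ.* f a b)))
          ≡⟨ ℤΣ.∑-cong Z (λ z → trans (ℤΣ.∑-cong (allFin n) λ b → sym (ℤΣ.*-distribˡ-∑ (allFin n) (φ (u , v) z) _))
                                      (sym (ℤΣ.*-distribˡ-∑ (allFin n) (φ (u , v) z) _))) ⟩
        ℤΣ.∑ Z (λ z → φ (u , v) z ℤ.* ℤΣ.∑ (allFin n) (λ b → ℤΣ.∑ (allFin n) (λ a → f a b)))
          ≡⟨ ℤΣ.∑-cong Z (λ z → trans (cong (φ (u , v) z ℤ.*_) centred) (ℤ.*-zeroʳ (φ (u , v) z))) ⟩
        ℤΣ.∑ Z (λ _ → 0ℤ)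
          ≡⟨ ℤΣ.∑-zero Z ⟩
        0ℤ ∎))
        where
        open ≡-Reasoning
        G : Vec (Fin n) p → ℤ
        G z = φ (u , v) z ℤ.* φ (w , q) z
        +n≢0 : ∀ {n} → .{{NonZero n}} → + n ≢ 0ℤ
        +n≢0 {suc n} ()
        cancel : ∀ {i} → + n ℤ.* i ≡ 0ℤ → i ≡ 0ℤ
        cancel eq = [ (λ n≡0 → ⊥-elim (+n≢0 n≡0)) , id ]′ (ℤ.i*j≡0⇒i≡0∨j≡0 (+ n) eq)
        off : ∀ z a b x → π w ≢ π x → π q ≢ π x → lookup ((z [ π q ]≔ b) [ π w ]≔ a) (π x) ≡ lookup z (π x)
        off z a b x w≢x q≢x = trans (lookup∘update′ (≢-sym w≢x) (z [ π q ]≔ b) a) (lookup∘update′ (≢-sym q≢x) z b)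
        fresh : ∀ z a b → G ((z [ π q ]≔ b) [ π w ]≔ a) ≡ φ (u , v) z ℤ.* f a b
        fresh z a b = cong₂ ℤ._*_
          (cong₂ f (off z a b u wu qu) (off z a b v wv qv))
          (cong₂ f (lookup∘update (π w) (z [ π q ]≔ b) a)
                   (trans (lookup∘update′ (≢-sym wq) (z [ π q ]≔ b) a) (lookup∘update (π q) z b)))

      cov≤1 : ∀ i j → cov i j ℤ.≤ + (N * (B * B))
      cov≤1 i j = ℤ.≤-trans (∑ℤ-mono Z λ z → ℤ.≤-trans (i≤+∣i∣ (φ i z ℤ.* φ j z))
          (ℤ.+≤+ (≤-trans (≤-reflexive (ℤ.abs-* (φ i z) (φ j z))) (*-mono-≤ (bounded _ _) (bounded _ _)))))
        (ℤ.≤-reflexive (trans (∑ℤ-pos Z _) (cong +_ (∑-const Z (B * B)))))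

      -- Without a coincidence the covariance vanishes. With one, `overlaps` computes to a
      -- successor, so `m≤m*n` passes from the trivial bound `cov≤1` to the claim.
      cov≤ : ∀ i j → cov i j ℤ.≤ + (N * (B * B) * overlaps i j)
      cov≤ (u , v) (w , q) with π w Fin.≟ π u | π w Fin.≟ π v | π q Fin.≟ π u | π q Fin.≟ π v | π w Fin.≟ π q
      ... | no wu | no wv | no qu | no qv | no wq = ℤ.≤-trans (ℤ.≤-reflexive (cov≡0 u v w q wu wv qu qv wq)) (ℤ.+≤+ z≤n)
      ... | yes _ | _     | _     | _     | _     = ℤ.≤-trans (cov≤1 (u , v) (w , q)) (ℤ.+≤+ (m≤m*n _ _))
      ... | no _  | yes _ | _     | _     | _     = ℤ.≤-trans (cov≤1 (u , v) (w , q)) (ℤ.+≤+ (m≤m*n _ _))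
      ... | no _  | no _  | yes _ | _     | _     = ℤ.≤-trans (cov≤1 (u , v) (w , q)) (ℤ.+≤+ (m≤m*n _ _))
      ... | no _  | no _  | no _  | yes _ | _     = ℤ.≤-trans (cov≤1 (u , v) (w , q)) (ℤ.+≤+ (m≤m*n _ _))
      ... | no _  | no _  | no _  | no _  | yes _ = ℤ.≤-trans (cov≤1 (u , v) (w , q)) (ℤ.+≤+ (m≤m*n _ _))

    -- The square expands into covariances. Only overlapping pairs of pairs can contribute
    -- positively, and `∑-overlaps` has counted them.
    second-moment : ∑ Z (λ z → ∣ pulledBack z ∣ * ∣ pulledBack z ∣) ≤ N * (B * B) * (5 * (m * m * collisions))
    second-moment = ℤ.drop‿+≤+ (begin
      + ∑ Z (λ z → ∣ pulledBack z ∣ * ∣ pulledBack z ∣)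
        ≡⟨ ∑ℤ-pos Z _ ⟨
      ℤΣ.∑ Z (λ z → + (∣ pulledBack z ∣ * ∣ pulledBack z ∣))
        ≡⟨ ℤΣ.∑-cong Z (λ z → +∣i∣*∣i∣ (pulledBack z)) ⟩
      ℤΣ.∑ Z (λ z → pulledBack z ℤ.* pulledBack z)
        ≡⟨ ℤΣ.∑-cong Z (λ z → ℤΣ.∑-*-∑ pairs pairs _ _) ⟩
      ℤΣ.∑ Z (λ z → ℤΣ.∑ pairs (λ i → ℤΣ.∑ pairs (λ j → φ i z ℤ.* φ j z)))
        ≡⟨ trans (ℤΣ.∑-swap Z pairs _) (ℤΣ.∑-cong pairs λ i → ℤΣ.∑-swap Z pairs _) ⟩
      ℤΣ.∑ pairs (λ i → ℤΣ.∑ pairs (λ j → cov i j))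
        ≤⟨ ∑ℤ-mono pairs (λ i → ∑ℤ-mono pairs (cov≤ i)) ⟩
      ℤΣ.∑ pairs (λ i → ℤΣ.∑ pairs (λ j → + (N * (B * B) * overlaps i j)))
        ≡⟨ trans (ℤΣ.∑-cong pairs λ i → ∑ℤ-pos pairs _) (∑ℤ-pos pairs _) ⟩
      + ∑ pairs (λ i → ∑ pairs (λ j → N * (B * B) * overlaps i j))
        ≡⟨ cong +_ (trans (∑-cong pairs λ i → sym (*-distribˡ-∑ pairs (N * (B * B)) _)) (sym (*-distribˡ-∑ pairs (N * (B * B)) _))) ⟩
      + (N * (B * B) * ∑ pairs (λ i → ∑ pairs (overlaps i)))
        ≡⟨ cong (λ k → + (N * (B * B) * k)) ∑-overlaps ⟩
      + (N * (B * B) * (5 * (m * m * collisions))) ∎)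
      where open ℤ.≤-Reasoning

-- Edge counts of sampled graphs

fromBool : Bool → ℕ
fromBool b = if b then 1 else 0

fromBool≤1 : ∀ b → fromBool b ≤ 1
fromBool≤1 true  = ≤-refl
fromBool≤1 false = z≤n

-- Ordered pairs match the index set `allPairs` of the second moment; `handshake` converts back to
-- edges.
degreeSum : ∀ {n} → SimpleGraph n → ℕ
degreeSum {n} G = ∑ (allFin n) (λ u → ∑ (allFin n) (λ v → fromBool (adj G u v)))

<ᵇ-true : ∀ {m n} → m < n → (m <ᵇ n) ≡ true
<ᵇ-true {zero}  {suc n} _         = refl
<ᵇ-true {suc m} {suc n} (s≤s m<n) = <ᵇ-true m<n

<ᵇ-false : ∀ {m n} → ¬ m < n → (m <ᵇ n) ≡ false
<ᵇ-false {m}     {zero}  _   = refl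
<ᵇ-false {zero}  {suc n} m≮n = ⊥-elim (m≮n (s≤s z≤n))
<ᵇ-false {suc m} {suc n} m≮n = <ᵇ-false (m≮n ∘ s≤s)

-- Each adjacency is seen in exactly one of the two directions of increasing index; on the diagonal
-- irreflexivity makes all terms vanish.
handshake : ∀ {n} (G : SimpleGraph n) → degreeSum G ≡ 2 * edgeCount G
handshake {n} G = begin
  degreeSum G
    ≡⟨ ∑-cong V (λ u → ∑-cong V (λ v → split u v)) ⟩
  ∑ V (λ u → ∑ V (λ v → up u v + up v u))
    ≡⟨ trans (∑-cong V λ u → ∑-distrib-+ V _ _) (∑-distrib-+ V _ _) ⟩
  ∑ V (λ u → ∑ V (up u)) + ∑ V (λ u → ∑ V (λ v → up v u))
    ≡⟨ cong₂ _+_ (sym count) (trans (∑-swap V V _) (sym count)) ⟩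
  edgeCount G + edgeCount G
    ≡⟨ cong (_+_ (edgeCount G)) (+-identityʳ (edgeCount G)) ⟨
  2 * edgeCount G ∎
  where
  open ≡-Reasoning
  V = allFin n
  up : Fin n → Fin n → ℕ
  up u v = fromBool ((toℕ u <ᵇ toℕ v) ∧ adj G u v)
  count : edgeCount G ≡ ∑ V (λ u → ∑ V (up u))
  count = trans (sum-map V _) (∑-cong V λ u → sum-map V _)
  split : ∀ u v → fromBool (adj G u v) ≡ up u v + up v u
  split u v with <-cmp (toℕ u) (toℕ v)
  ... | tri< u<v _ v≮u rewrite <ᵇ-true u<v | <ᵇ-false v≮u = sym (+-identityʳ _)
  ... | tri> u≮v _ v<u rewrite <ᵇ-true v<u | <ᵇ-false u≮v = cong fromBool (adj-sym G u v)
  ... | tri≈ u≮v u≡v v≮u rewrite <ᵇ-false u≮v | <ᵇ-false v≮u | Fin.toℕ-injective u≡v | adj-irrefl G v = refl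

2*nC2 : ∀ n → 2 * (suc n C 2) ≡ suc n * n
2*nC2 zero    = refl
2*nC2 (suc n) = begin
  2 * (suc (suc n) C 2)          ≡⟨ cong (2 *_) (nCk+nC[k+1]≡[n+1]C[k+1] (suc n) 1) ⟨
  2 * (suc n C 1 + suc n C 2)    ≡⟨ *-distribˡ-+ 2 (suc n C 1) (suc n C 2) ⟩
  2 * (suc n C 1) + 2 * (suc n C 2) ≡⟨ cong₂ _+_ (cong (2 *_) (nC1≡n (suc n))) (2*nC2 n) ⟩
  2 * suc n + suc n * n          ≡⟨ eq n ⟩
  suc (suc n) * suc n ∎
  where
  open ≡-Reasoning
  eq : ∀ n → 2 * suc n + suc n * n ≡ suc (suc n) * suc n
  eq = solve-∀

-- Converts a sampling error of order n² into the `n C 2` of the density. It fails at n = 1.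
n*n≤4*nC2 : ∀ {n} → 2 ≤ n → n * n ≤ 4 * (n C 2)
n*n≤4*nC2 {suc zero}    (s≤s ())
n*n≤4*nC2 {suc (suc n)} _ = begin
  suc (suc n) * suc (suc n)             ≤⟨ m≤m+n _ (n * suc (suc n)) ⟩
  suc (suc n) * suc (suc n) + n * suc (suc n) ≡⟨ eq n ⟩
  2 * (suc (suc n) * suc n)             ≡⟨ cong (2 *_) (2*nC2 (suc n)) ⟨
  2 * (2 * (suc (suc n) C 2))           ≡⟨ *-assoc 2 2 (suc (suc n) C 2) ⟨
  4 * (suc (suc n) C 2) ∎
  where
  open ≤-Reasoning
  eq : ∀ n → suc (suc n) * suc (suc n) + n * suc (suc n) ≡ 2 * (suc (suc n) * suc n)
  eq = solve-∀

-- A blow-up of the subgraph induced on the image of `r`: vertices with the same image are never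
-- adjacent, by irreflexivity.
pullback : ∀ {m n} → (Fin m → Fin n) → SimpleGraph n → SimpleGraph m
pullback r G = record
  { adj        = λ u v → adj G (r u) (r v)
  ; adj-sym    = λ u v → adj-sym G (r u) (r v)
  ; adj-irrefl = λ u → adj-irrefl G (r u)
  }

∑ℤ-minus : {X : Set} (xs : List X) (g : X → ℕ) (c : ℕ) →
           ℤΣ.∑ xs (λ x → + g x ℤ.- + c) ≡ + ∑ xs g ℤ.- + (length xs * c)
∑ℤ-minus xs g c = trans (ℤΣ.∑-distrib-+ xs _ _) (cong₂ ℤ._+_ (∑ℤ-pos xs g)
  (trans (∑ℤ-const xs (ℤ.- + c)) (trans (sym (ℤ.neg-distribʳ-* (+ length xs) (+ c)))
    (cong ℤ.-_ (sym (ℤ.pos-* (length xs) c))))))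

∣+m-+n∣≤ : ∀ {m n B} → m ≤ B → n ≤ B → ∣ + m ℤ.- + n ∣ ≤ B
∣+m-+n∣≤ {m} {n} m≤B n≤B rewrite ℤ.m-n≡m⊖n m n with ≤-total m n
... | inj₁ m≤n = ≤-trans (≤-reflexive (ℤ.∣⊖∣-≤ m≤n)) (≤-trans (m∸n≤m n m) n≤B)
... | inj₂ n≤m = ≤-trans (≤-reflexive (cong ∣_∣ (ℤ.⊖-≥ n≤m))) (≤-trans (m∸n≤m m n) m≤B)

n∸m≤∣+m-+n∣ : ∀ m n → n ∸ m ≤ ∣ + m ℤ.- + n ∣
n∸m≤∣+m-+n∣ m n rewrite ℤ.m-n≡m⊖n m n with ≤-total m n
... | inj₁ m≤n = ≤-reflexive (sym (ℤ.∣⊖∣-≤ m≤n))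
... | inj₂ n≤m = ≤-trans (≤-reflexive (m≤n⇒m∸n≡0 n≤m)) z≤n

module _ {n p} .{{_ : NonZero n}} (π : Fin n → Fin p) (G : SimpleGraph n) where

  private
    V = allFin n
    P = allPairs n
    D = degreeSum G

    -- The deviation of adjacency from its mean `D` / n² over ordered pairs, multiplied by n² to
    -- stay integral. This scaling is why the kernel bound is n².
    f : Fin n → Fin n → ℤ
    f a b = + (n * n * fromBool (adj G a b)) ℤ.- + D

    D≤n² : D ≤ n * n
    D≤n² = ≤-trans (∑-mono V λ u → ∑-mono V λ v → fromBool≤1 (adj G u v))
      (≤-reflexive (trans (∑-cong V λ u → ∑-allFin-const n 1) (trans (∑-allFin-const n _) (cong (n *_) (*-identityʳ n)))))

    bounded : ∀ a b → ∣ f a b ∣ ≤ n * n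
    bounded a b = ∣+m-+n∣≤
      (≤-trans (*-monoʳ-≤ (n * n) (fromBool≤1 (adj G a b))) (≤-reflexive (*-identityʳ (n * n)))) D≤n²

    centred : ℤΣ.∑ V (λ b → ℤΣ.∑ V (λ a → f a b)) ≡ 0ℤ
    centred = begin
      ℤΣ.∑ V (λ b → ℤΣ.∑ V (λ a → f a b))
        ≡⟨ ℤΣ.∑-cong V (λ b → ∑ℤ-minus V _ D) ⟩
      ℤΣ.∑ V (λ b → + ∑ V (λ a → n * n * fromBool (adj G a b)) ℤ.- + (length V * D))
        ≡⟨ ∑ℤ-minus V _ _ ⟩
      + ∑ V (λ b → ∑ V (λ a → n * n * fromBool (adj G a b))) ℤ.- + (length V * (length V * D))
        ≡⟨ cong₂ (λ x y → + x ℤ.- + y)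
             (trans (∑-swap V V _) (trans (∑-cong V λ a → sym (*-distribˡ-∑ V (n * n) _)) (sym (*-distribˡ-∑ V (n * n) _))))
             (trans (cong (λ l → l * (l * D)) (length-allFin n)) (sym (*-assoc n n D))) ⟩
      + (n * n * D) ℤ.- + (n * n * D)
        ≡⟨ ℤ.+-inverseʳ (+ (n * n * D)) ⟩
      0ℤ ∎
      where open ≡-Reasoning

    module M = SecondMoment π {B = n * n} f bounded centred

  resampled : Vec (Fin n) p → SimpleGraph n
  resampled z = pullback (lookup z ∘ π) G

  -- Truncated subtraction records only a loss of edges, as a gain is harmless. The factor n² is the
  -- scaling of `f`.
  deficit : Vec (Fin n) p → ℕ
  deficit z = n * n * (D ∸ degreeSum (resampled z))

  private
    length-pairs : length P ≡ n * n
    length-pairs = begin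
      length P                                ≡⟨ *-identityʳ (length P) ⟨
      length P * 1                            ≡⟨ ∑-const P 1 ⟨
      ∑ P (λ _ → 1)                           ≡⟨ ∑-cartesian _,_ V V _ ⟩
      ∑ V (λ _ → ∑ V (λ _ → 1))               ≡⟨ ∑-allFin-const n _ ⟩
      n * ∑ V (λ _ → 1)                       ≡⟨ cong (n *_) (trans (∑-allFin-const n 1) (*-identityʳ n)) ⟩
      n * n ∎
      where open ≡-Reasoning

    pulledBack≡ : ∀ z → M.pulledBack z ≡ + (n * n * degreeSum (resampled z)) ℤ.- + (n * n * D)
    pulledBack≡ z = trans (∑ℤ-minus P _ D) (cong₂ (λ x l → + x ℤ.- + (l * D))
      (trans (sym (*-distribˡ-∑ P (n * n) _)) (cong (n * n *_) (∑-cartesian _,_ V V _))) length-pairs)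

    deficit≤ : ∀ z → deficit z ≤ ∣ M.pulledBack z ∣
    deficit≤ z = begin
      n * n * (D ∸ E)                                ≡⟨ *-distribˡ-∸ (n * n) D E ⟩
      n * n * D ∸ n * n * E                          ≤⟨ n∸m≤∣+m-+n∣ (n * n * E) (n * n * D) ⟩
      ∣ + (n * n * E) ℤ.- + (n * n * D) ∣            ≡⟨ cong ∣_∣ (pulledBack≡ z) ⟨
      ∣ M.pulledBack z ∣ ∎
      where
      open ≤-Reasoning
      E = degreeSum (resampled z)

  ∑-deficit² : ∑ (tuples n p) (λ z → deficit z * deficit z) ≤
               length (tuples n p) * (n * n * (n * n)) * (5 * (n * n * collisions π))
  ∑-deficit² = ≤-trans (∑-mono (tuples n p) λ z → *-mono-≤ (deficit≤ z) (deficit≤ z)) M.second-moment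

-- Averages over a uniform `π`: the n diagonal pairs always collide, and every other pair collides
-- with probability at most 1/s.
few-collisions : ∀ s n → .{{_ : NonZero s}} → ∃ λ (π : Vec (Fin s) n) → s * collisions (lookup π) ≤ s * n + n * n
few-collisions s n with ∑-<⇒∃< T bound
  where
  T = tuples s n
  L = length T
  V = allFin n
  same : Fin n → Fin n → Vec (Fin s) n → ℕ
  same u v π = indicator (lookup π u Fin.≟ lookup π v)

  each : ∀ u v → s * ∑ T (same u v) ≤ s * L * indicator (u Fin.≟ v) + L
  each u v with u Fin.≟ v
  ... | no u≢v = ≤-trans (n*∑-collision u≢v) (m≤n+m L _)
  ... | yes _  = ≤-trans (*-monoʳ-≤ s (∑-mono T λ π → indicator≤1 (lookup π u Fin.≟ lookup π v)))
    (≤-trans (≤-reflexive (trans (cong (s *_) (∑-const T 1)) (sym (*-assoc s L 1)))) (m≤m+n _ L))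

  diagonal : ∑ V (λ u → ∑ V (λ v → indicator (u Fin.≟ v))) ≤ n
  diagonal = ≤-trans (≤-reflexive (∑-swap V V _)) (≤-trans (∑-mono V ∑-indicator-≟)
    (≤-reflexive (trans (∑-allFin-const n 1) (*-identityʳ n))))

  total : ∑ T (λ π → s * collisions (lookup π)) ≤ L * (s * n + n * n)
  total = begin
    ∑ T (λ π → s * collisions (lookup π))
      ≡⟨ *-distribˡ-∑ T s _ ⟨
    s * ∑ T (λ π → ∑ V (λ u → ∑ V (λ v → same u v π)))
      ≡⟨ cong (s *_) (trans (∑-swap T V _) (∑-cong V λ u → ∑-swap T V _)) ⟩
    s * ∑ V (λ u → ∑ V (λ v → ∑ T (same u v)))
      ≡⟨ trans (*-distribˡ-∑ V s _) (∑-cong V λ u → *-distribˡ-∑ V s _) ⟩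
    ∑ V (λ u → ∑ V (λ v → s * ∑ T (same u v)))
      ≤⟨ ∑-mono V (λ u → ∑-mono V (each u)) ⟩
    ∑ V (λ u → ∑ V (λ v → s * L * indicator (u Fin.≟ v) + L))
      ≡⟨ trans (∑-cong V λ u → ∑-distrib-+ V _ _) (∑-distrib-+ V _ _) ⟩
    ∑ V (λ u → ∑ V (λ v → s * L * indicator (u Fin.≟ v))) + ∑ V (λ _ → ∑ V (λ _ → L))
      ≡⟨ cong₂ _+_ (trans (∑-cong V λ u → sym (*-distribˡ-∑ V (s * L) _)) (sym (*-distribˡ-∑ V (s * L) _)))
                   (trans (∑-allFin-const n _) (cong (n *_) (∑-allFin-const n L))) ⟩
    s * L * ∑ V (λ u → ∑ V (λ v → indicator (u Fin.≟ v))) + n * (n * L)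
      ≤⟨ +-monoˡ-≤ _ (*-monoʳ-≤ (s * L) diagonal) ⟩
    s * L * n + n * (n * L)
      ≡⟨ eq s L n ⟩
    L * (s * n + n * n) ∎
    where
    open ≤-Reasoning
    eq : ∀ s L n → s * L * n + n * (n * L) ≡ L * (s * n + n * n)
    eq = solve-∀

  -- The successor makes the average strict, as `∑-<⇒∃<` demands; `≤-pred` takes it away again.
  bound : ∑ T (λ π → s * collisions (lookup π)) < ∑ T (λ _ → suc (s * n + n * n))
  bound = ≤-trans (s≤s total) (≤-trans (*-monoʳ-< L {{tuples-nonempty s n}} (n<1+n _)) (≤-reflexive (sym (∑-const T _))))
... | π , lt = π , ≤-pred lt

-- Homomorphic copies in sampled systems

-- Puts `H` in the family of its images, which settles the easy inequality.
image-refl : ∀ {k} (H : PCT k) → IsColorHomImage H H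
image-refl H = record
  { f = id ; f̃ = id ; f̃-inj = id ; f̃-edge = λ e → inj₁ (refl , refl)
  ; dom-to = λ e c eq → c , eq ; dom-from = λ e c eq → e , refl , c , eq ; colors = λ e c eq → eq }
  , λ e → e , id

module Copies {k : ℕ} (H : PCT k) where

  -- A potential homomorphic copy, given by the sample coordinate of each vertex and the color of
  -- each edge. Vectors, unlike functions, can be listed for a union bound, and their number does
  -- not depend on n.
  Placement : ℕ → Set
  Placement s = Vec (Fin s) (nV H) × Vec (Fin k) (nE H)

  placements : ∀ s → List (Placement s)
  placements s = cartesianProduct (tuples s (nV H)) (tuples k (nE H))

  ValidColoring : (Fin (nE H) → Fin k) → Set
  ValidColoring ρ = (∀ e e′ → ρ e ≡ ρ e′ → e ≡ e′) × (∀ e c → col H e ≡ just c → ρ e ≡ c)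

  ValidColoring? : ∀ ρ → Dec (ValidColoring ρ)
  ValidColoring? ρ =
    (Fin.all? λ e → Fin.all? λ e′ → (ρ e Fin.≟ ρ e′) →-dec (e Fin.≟ e′)) ×-dec
    (Fin.all? λ e → Fin.all? λ c → Maybe.≡-dec Fin._≟_ (col H e) (just c) →-dec (ρ e Fin.≟ c))

  module _ {n} (Gs : GraphSystem k n) where

    -- Once `ρ` is fixed, edge `e` must land in the single graph `Gs (ρ e)`, so plain homomorphism
    -- counting applies.
    open module ColoredHoms (ρ : Fin (nE H) → Fin k) = Homs (ends H) (Gs ∘ ρ) using (Hom; Hom?; homs; homs-few)

    -- A rainbow copy of `H` except that vertices may be identified.
    HomCopy : (Fin (nE H) → Fin k) → (Fin (nV H) → Fin n) → Set
    HomCopy ρ y = ValidColoring ρ × Hom ρ y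

    HomCopy? : ∀ ρ y → Dec (HomCopy ρ y)
    HomCopy? ρ y = ValidColoring? ρ ×-dec Hom? ρ y

    HomCopy-resp : ∀ {ρ ρ′ y y′} → (∀ e → ρ e ≡ ρ′ e) → (∀ b → y b ≡ y′ b) → HomCopy ρ y → HomCopy ρ′ y′
    HomCopy-resp ρ≗ y≗ ((inj , ext) , hom) =
      ((λ e e′ eq → inj e e′ (trans (ρ≗ e) (trans eq (sym (ρ≗ e′))))) ,
       (λ e c eq → trans (sym (ρ≗ e)) (ext e c eq))) ,
      λ e → trans (cong (λ c → adj (Gs c) _ _) (sym (ρ≗ e)))
              (trans (cong₂ (adj (Gs _)) (sym (y≗ _)) (sym (y≗ _))) (hom e))

    module _ {s : ℕ} where
      -- A placement reads only the first s coordinates of `z`; the last `nV H` are reserved as the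
      -- private coordinates of `stage`.
      Contains? : (i : Placement s) (z : Vec (Fin n) (s + nV H)) →
                  Dec (HomCopy (lookup (proj₂ i)) (λ b → lookup z (lookup (proj₁ i) b ↑ˡ nV H)))
      Contains? i z = HomCopy? (lookup (proj₂ i)) (λ b → lookup z (lookup (proj₁ i) b ↑ˡ nV H))

      -- An invalid coloring contributes nothing. For a valid one, an injective homomorphism would
      -- be a rainbow copy of `H`, so freeness is the hypothesis of `homs-few`.
      few-placed : ∀ c → c ^ (2 ^ nV H) * (nV H * nV H) < n → RainbowFree Gs (Singleton H) → ∀ i →
                   c * ∑ (tuples n (s + nV H)) (λ z → indicator (Contains? i z)) ≤ length (tuples n (s + nV H))
      few-placed c n-large free i@(g , ρ) with ValidColoring? (lookup ρ)
      ... | no _ = ≤-trans (≤-reflexive (trans (cong (c *_) (∑-zero (tuples n (s + nV H)))) (*-zeroʳ c))) z≤n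
      ... | yes valid@(inj , ext) = ≤-trans
        (*-monoʳ-≤ c (∑-mono (tuples n (s + nV H)) λ z →
          let hom? = Hom? (lookup ρ) (λ b → lookup z (lookup g b ↑ˡ nV H))
          in indicator-mono (yes valid ×-dec hom?) hom? proj₂))
        (homs-few (lookup ρ) (lookup g) c n-large
          λ y y-inj hom → free H refl (y , y-inj , lookup ρ , inj _ _ , ext , hom))

      copies : Vec (Fin n) (s + nV H) → ℕ
      copies z = ∑ (placements s) (λ i → indicator (Contains? i z))

      few-copies : ∀ c → c ^ (2 ^ nV H) * (nV H * nV H) < n → RainbowFree Gs (Singleton H) →
                   c * ∑ (tuples n (s + nV H)) copies ≤ length (placements s) * length (tuples n (s + nV H))
      few-copies c n-large free = begin
        c * ∑ Z copies
          ≡⟨ cong (c *_) (∑-swap Z (placements s) _) ⟩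
        c * ∑ (placements s) (λ i → ∑ Z (λ z → indicator (Contains? i z)))
          ≡⟨ *-distribˡ-∑ (placements s) c _ ⟩
        ∑ (placements s) (λ i → c * ∑ Z (λ z → indicator (Contains? i z)))
          ≤⟨ ∑-mono (placements s) (few-placed c n-large free) ⟩
        ∑ (placements s) (λ _ → length Z)
          ≡⟨ ∑-const (placements s) (length Z) ⟩
        length (placements s) * length Z ∎
        where
        open ≤-Reasoning
        Z = tuples n (s + nV H)

  -- Composes the copy with the color homomorphism. Injectivity of `f̃` keeps the colors distinct,
  -- whereas `f` may identify vertices.
  image-copy⇒HomCopy : ∀ {n} (Gs : GraphSystem k n) {F} → IsColorHomImage H F → RainbowCopy Gs F →
                       ∃ λ ρ → ∃ λ y → HomCopy Gs ρ y
  image-copy⇒HomCopy Gs {F} (φ , _) (g , _ , ρ , ρ-inj , ext , edges) =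
    ρ ∘ f̃ , g ∘ f ,
    ((λ e e′ eq → f̃-inj (ρ-inj eq)) , (λ e c eq → ext (f̃ e) c (colors e c eq))) ,
    edge
    where
    open ColorHom φ
    edge : ∀ e → adj (Gs (ρ (f̃ e))) (g (f (proj₁ (ends H e)))) (g (f (proj₂ (ends H e)))) ≡ true
    edge e with f̃-edge e
    ... | inj₁ (a , b) = trans (cong₂ (λ x y → adj (Gs (ρ (f̃ e))) (g x) (g y)) (sym a) (sym b)) (edges (f̃ e))
    ... | inj₂ (a , b) = trans (adj-sym (Gs (ρ (f̃ e))) _ _)
      (trans (cong₂ (λ x y → adj (Gs (ρ (f̃ e))) (g x) (g y)) (sym a) (sym b)) (edges (f̃ e)))

  -- A copy of an image in the pulled-back system yields a map `y` on the vertices of `H`; then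
  -- `π ∘ y` and the coloring form a placement that `copies` would have counted.
  copies≡0⇒free : ∀ {m n s} (Gs : GraphSystem k n) (π : Fin m → Fin s) (z : Vec (Fin n) (s + nV H)) → copies Gs z ≡ 0 →
                  RainbowFree (pullback (λ u → lookup z (π u ↑ˡ nV H)) ∘ Gs) (AllImages H)
  copies≡0⇒free {s = s} Gs π z none F image copy
    with ρ , y , valid , hom ← image-copy⇒HomCopy (pullback (λ u → lookup z (π u ↑ˡ nV H)) ∘ Gs) image copy =
    <⇒≱ (n<1+n 0) (begin
      1                                   ≡⟨ indicator≡1 (Contains? Gs i z) contained ⟨
      indicator (Contains? Gs i z)        ≤⟨ ∑-≥ (∈-cartesianProduct⁺ (∈-tuples (tabulate (π ∘ y))) (∈-tuples (tabulate ρ)))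
                                                 (λ i → indicator (Contains? Gs i z)) ⟩
      copies Gs z                         ≡⟨ none ⟩
      0 ∎)
    where
    open ≤-Reasoning
    i : Placement s
    i = tabulate (π ∘ y) , tabulate ρ
    contained : HomCopy Gs (lookup (tabulate ρ)) (λ b → lookup z (lookup (tabulate (π ∘ y)) b ↑ˡ nV H))
    contained = HomCopy-resp Gs (λ e → sym (lookup∘tabulate ρ e))
      (λ b → cong (λ x → lookup z (x ↑ˡ nV H)) (sym (lookup∘tabulate (π ∘ y) b))) (valid , hom)

-- Choice of a good sample

collisions-↑ˡ : ∀ {m s} (π : Fin m → Fin s) h → collisions (λ u → π u ↑ˡ h) ≤ collisions π
collisions-↑ˡ {m} π h = ∑-mono (allFin m) λ u → ∑-mono (allFin m) λ v →
  indicator-mono (_ Fin.≟ _) (_ Fin.≟ _) (Fin.↑ˡ-injective h (π u) (π v))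

*-self-cancel-< : ∀ {a b} → a * a < b * b → a < b
*-self-cancel-< {a} {b} lt with a <? b
... | yes a<b = a<b
... | no a≮b  = ⊥-elim (<⇒≱ lt (*-mono-≤ (≮⇒≥ a≮b) (≮⇒≥ a≮b)))

-- Taking square roots and writing the deficit as 2n² times the edge loss leaves 4T times the loss
-- below n², which is at most 4 times `n C 2`.
small-deficit : ∀ {n p} T .{{_ : NonZero n}} → 2 ≤ n → (π : Fin n → Fin p) (G : SimpleGraph n) (z : Vec (Fin n) p) →
                (2 * T * deficit π G z) * (2 * T * deficit π G z) < n * n * (n * n) * (n * n * (n * n)) →
                T * edgeCount G ≤ T * edgeCount (resampled π G z) + n C 2
small-deficit {n} T 2≤n π G z small = begin
  T * e                ≤⟨ *-monoʳ-≤ T (m≤n+m∸n e e′) ⟩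
  T * (e′ + (e ∸ e′))  ≡⟨ *-distribˡ-+ T e′ (e ∸ e′) ⟩
  T * e′ + T * (e ∸ e′) ≤⟨ +-monoʳ-≤ (T * e′) (*-cancelˡ-≤ 4 (<⇒≤ (≤-trans gap (n*n≤4*nC2 2≤n)))) ⟩
  T * e′ + n C 2 ∎
  where
  open ≤-Reasoning
  e = edgeCount G
  e′ = edgeCount (resampled π G z)
  instance
    n²≢0 : NonZero (n * n)
    n²≢0 = m*n≢0 n n
  eq : ∀ a T x → 2 * T * (a * (2 * x)) ≡ a * (4 * (T * x))
  eq = solve-∀
  deficit≡ : deficit π G z ≡ n * n * (2 * (e ∸ e′))
  deficit≡ = cong (n * n *_) (trans (cong₂ _∸_ (handshake G) (handshake (resampled π G z))) (sym (*-distribˡ-∸ 2 e e′)))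
  gap : 4 * (T * (e ∸ e′)) < n * n
  gap = *-cancelˡ-< (n * n) _ _ (subst (_< n * n * (n * n))
    (trans (cong (2 * T *_) deficit≡) (eq (n * n) T (e ∸ e′)))
    (*-self-cancel-< {2 * T * deficit π G z} small))

-- The factor 80 T² k makes the k expected losses below add up to at most half of the budget Q² = n⁸:
-- each is at most (2T)² · 5 n⁶ · collisions, where collisions ≤ 2 n² / s.
module Sampling {k : ℕ} (H : PCT k) (T s : ℕ) (s≡ : s ≡ 80 * (T * T) * k) .{{_ : NonZero s}} where

  private
    h M c : ℕ
    h = nV H
    M = length (Copies.placements H s)
    -- Makes the M placements, each realised with probability at most 1/c, contribute less than 1/2
    -- in total.
    c = 1 + 2 * M

  -- The summands secure 2 ≤ n for `n*n≤4*nC2`, s ≤ n for the collision bound, and the strict lower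
  -- bound on n in `homs-few`.
  threshold : ℕ
  threshold = 2 + s + suc (c ^ (2 ^ h) * (h * h))

  module _ {n} (n-large : threshold ≤ n) (Gs : GraphSystem k n) (free : RainbowFree Gs (Singleton H)) where

    private
      open Copies H

      2≤n : 2 ≤ n
      2≤n = ≤-trans (m≤m+n 2 s) (≤-trans (m≤m+n (2 + s) _) n-large)
      s≤n : s ≤ n
      s≤n = ≤-trans (m≤n+m s 2) (≤-trans (m≤m+n (2 + s) _) n-large)
      homs<n : c ^ (2 ^ h) * (h * h) < n
      homs<n = ≤-trans (m≤n+m _ (2 + s)) n-large

      instance
        n≢0 : NonZero n
        n≢0 = >-nonZero (≤-trans (s≤s z≤n) 2≤n)

      π₀ : Vec (Fin s) n
      π₀ = proj₁ (few-collisions s n)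

      π : Fin n → Fin (s + h)
      π u = lookup π₀ u ↑ˡ h

      s*collisions : s * collisions π ≤ 2 * (n * n)
      s*collisions = begin
        s * collisions π           ≤⟨ *-monoʳ-≤ s (collisions-↑ˡ (lookup π₀) h) ⟩
        s * collisions (lookup π₀) ≤⟨ proj₂ (few-collisions s n) ⟩
        s * n + n * n              ≤⟨ +-monoˡ-≤ (n * n) (*-monoˡ-≤ n s≤n) ⟩
        n * n + n * n              ≡⟨ cong (_+_ (n * n)) (+-identityʳ (n * n)) ⟨
        2 * (n * n) ∎
        where open ≤-Reasoning

      Z = tuples n (s + h)
      N = length Z
      Q = n * n * (n * n)

      loss : Fin k → Vec (Fin n) (s + h) → ℕ
      loss i z = (2 * T * deficit π (Gs i) z) * (2 * T * deficit π (Gs i) z)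

      losses : Vec (Fin n) (s + h) → ℕ
      losses z = ∑ (allFin k) (λ i → loss i z)

      ∑-loss : ∀ i → s * ∑ Z (loss i) ≤ 40 * (T * T) * (N * (Q * Q))
      ∑-loss i = begin
        s * ∑ Z (loss i)
          ≡⟨ cong (s *_) (trans (∑-cong Z λ z → eq₁ T (deficit π (Gs i) z)) (sym (*-distribˡ-∑ Z (4 * (T * T)) _))) ⟩
        s * (4 * (T * T) * ∑ Z (λ z → deficit π (Gs i) z * deficit π (Gs i) z))
          ≤⟨ *-monoʳ-≤ s (*-monoʳ-≤ (4 * (T * T)) (∑-deficit² π (Gs i))) ⟩
        s * (4 * (T * T) * (N * Q * (5 * (n * n * collisions π))))
          ≡⟨ eq₂ s (T * T) (N * Q) (n * n) (collisions π) ⟩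
        20 * (T * T) * (N * Q * (n * n)) * (s * collisions π)
          ≤⟨ *-monoʳ-≤ (20 * (T * T) * (N * Q * (n * n))) s*collisions ⟩
        20 * (T * T) * (N * Q * (n * n)) * (2 * (n * n))
          ≡⟨ eq₃ (T * T) N Q (n * n) ⟩
        40 * (T * T) * (N * (Q * Q)) ∎
        where
        open ≤-Reasoning
        eq₁ : ∀ T d → (2 * T * d) * (2 * T * d) ≡ 4 * (T * T) * (d * d)
        eq₁ = solve-∀
        eq₂ : ∀ s T² NQ n² x → s * (4 * T² * (NQ * (5 * (n² * x)))) ≡ 20 * T² * (NQ * n²) * (s * x)
        eq₂ = solve-∀
        eq₃ : ∀ T² N Q n² → 20 * T² * (N * Q * n²) * (2 * n²) ≡ 40 * T² * (N * (Q * (n² * n²)))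
        eq₃ = solve-∀

      2*∑-losses : 2 * ∑ Z losses ≤ N * (Q * Q)
      2*∑-losses = *-cancelˡ-≤ s (begin
        s * (2 * ∑ Z losses)
          ≡⟨ eq₁ s (∑ Z losses) ⟩
        2 * (s * ∑ Z losses)
          ≡⟨ cong (2 *_) (trans (cong (s *_) (∑-swap Z (allFin k) _)) (*-distribˡ-∑ (allFin k) s _)) ⟩
        2 * ∑ (allFin k) (λ i → s * ∑ Z (loss i))
          ≤⟨ *-monoʳ-≤ 2 (∑-mono (allFin k) ∑-loss) ⟩
        2 * ∑ (allFin k) (λ _ → 40 * (T * T) * (N * (Q * Q)))
          ≡⟨ cong (2 *_) (∑-allFin-const k _) ⟩
        2 * (k * (40 * (T * T) * (N * (Q * Q))))
          ≡⟨ trans (eq₂ k (T * T) (N * (Q * Q))) (cong (_* (N * (Q * Q))) (sym s≡)) ⟩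
        s * (N * (Q * Q)) ∎)
        where
        open ≤-Reasoning
        eq₁ : ∀ s x → s * (2 * x) ≡ 2 * (s * x)
        eq₁ = solve-∀
        eq₂ : ∀ k T² x → 2 * (k * (40 * T² * x)) ≡ 80 * T² * k * x
        eq₂ = solve-∀

      2*∑-copies : 2 * ∑ Z (copies Gs) < N
      2*∑-copies = *-cancelˡ-< c _ _ (begin-strict
        c * (2 * ∑ Z (copies Gs))  ≡⟨ eq c (∑ Z (copies Gs)) ⟩
        2 * (c * ∑ Z (copies Gs))  ≤⟨ *-monoʳ-≤ 2 (few-copies Gs c homs<n free) ⟩
        2 * (M * N)                ≡⟨ *-assoc 2 M N ⟨
        2 * M * N                  <⟨ *-monoˡ-< N {{tuples-nonempty n (s + h)}} (n<1+n (2 * M)) ⟩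
        c * N ∎)
        where
        open ≤-Reasoning
        eq : ∀ c x → c * (2 * x) ≡ 2 * (c * x)
        eq = solve-∀

      -- Combines all requirements in one average. A copy weighs as much as the whole budget Q², so
      -- a value below Q² excludes copies and keeps each single loss below Q².
      potential : Vec (Fin n) (s + h) → ℕ
      potential z = losses z + Q * Q * copies Gs z

      instance
        Q²≢0 : NonZero (Q * Q)
        Q²≢0 = m*n≢0 Q Q {{Q≢0}} {{Q≢0}}
          where
          n²≢0 : NonZero (n * n)
          n²≢0 = m*n≢0 n n
          Q≢0 : NonZero Q
          Q≢0 = m*n≢0 (n * n) (n * n) {{n²≢0}} {{n²≢0}}

      -- Losses take at most half of the budget on average and copies strictly less than half.
      ∑-potential : ∑ Z potential < ∑ Z (λ _ → Q * Q)
      ∑-potential = *-cancelˡ-< 2 _ _ (begin-strict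
        2 * ∑ Z potential
          ≡⟨ cong (2 *_) (trans (∑-distrib-+ Z _ _) (cong (_+_ (∑ Z losses)) (sym (*-distribˡ-∑ Z (Q * Q) _)))) ⟩
        2 * (∑ Z losses + Q * Q * ∑ Z (copies Gs))
          ≡⟨ eq₁ (∑ Z losses) (Q * Q) (∑ Z (copies Gs)) ⟩
        2 * ∑ Z losses + Q * Q * (2 * ∑ Z (copies Gs))
          <⟨ +-mono-≤-< 2*∑-losses (*-monoʳ-< (Q * Q) 2*∑-copies) ⟩
        N * (Q * Q) + Q * Q * N
          ≡⟨ eq₂ N (Q * Q) ⟩
        2 * (N * (Q * Q))
          ≡⟨ cong (2 *_) (∑-const Z (Q * Q)) ⟨
        2 * ∑ Z (λ _ → Q * Q) ∎)
        where
        open ≤-Reasoning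
        eq₁ : ∀ x q y → 2 * (x + q * y) ≡ 2 * x + q * (2 * y)
        eq₁ = solve-∀
        eq₂ : ∀ N q → N * q + q * N ≡ 2 * (N * q)
        eq₂ = solve-∀

      copies≡0 : ∀ z → potential z < Q * Q → copies Gs z ≡ 0
      copies≡0 z small = n<1⇒n≡0 (*-cancelˡ-< (Q * Q) (copies Gs z) 1 (begin-strict
        Q * Q * copies Gs z  ≤⟨ m≤n+m (Q * Q * copies Gs z) (losses z) ⟩
        potential z          <⟨ small ⟩
        Q * Q                ≡⟨ *-identityʳ (Q * Q) ⟨
        Q * Q * 1            ∎))
        where open ≤-Reasoning

      loss< : ∀ z → potential z < Q * Q → ∀ i → loss i z < Q * Q
      loss< z small i = begin-strict
        loss i z     ≤⟨ ∑-≥ (∈-allFin i) (λ i → loss i z) ⟩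
        losses z     ≤⟨ m≤m+n (losses z) (Q * Q * copies Gs z) ⟩
        potential z  <⟨ small ⟩
        Q * Q        ∎
        where open ≤-Reasoning

      goodSample : ∃ λ z → potential z < Q * Q
      goodSample = ∑-<⇒∃< Z ∑-potential

    sample : ∃ λ (Gs′ : GraphSystem k n) → RainbowFree Gs′ (AllImages H) ×
             (∀ i → T * edgeCount (Gs i) ≤ T * edgeCount (Gs′ i) + n C 2)
    sample =
      (λ i → resampled π (Gs i) (proj₁ goodSample)) ,
      copies≡0⇒free Gs (lookup π₀) (proj₁ goodSample) (copies≡0 (proj₁ goodSample) (proj₂ goodSample)) ,
      (λ i → small-deficit T 2≤n π (Gs i) (proj₁ goodSample) (loss< (proj₁ goodSample) (proj₂ goodSample) i))

theorem4p7 : ∀ (k : ℕ) → 1 ≤ k → (H : PCT k) → Rainbow H →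
    SameDensity k (Singleton H) (AllImages H)
theorem4p7 k 1≤k H rainbow = forward , backward
  where
  -- The resampled system has the same n vertices, and T = t + 1 makes its loss at most a 1/(t + 1)
  -- fraction of `n C 2`.
  forward : DensityLE k (Singleton H) (AllImages H)
  forward t = threshold , λ n n-large m Gs free m≤ →
    let Gs′ , free′ , close = sample n-large Gs free
    in Gs′ , free′ , λ i → ≤-trans (*-monoʳ-≤ (suc t) (m≤ i)) (close i)
    where
    instance
      -- The hypothesis 1 ≤ k enters here: the number s of coordinates must be positive.
      s≢0 : NonZero (80 * (suc t * suc t) * k)
      s≢0 = m*n≢0 (80 * (suc t * suc t)) k {{_}} {{>-nonZero 1≤k}}
    open Sampling H (suc t) (80 * (suc t * suc t) * k) refl
  -- The given system itself serves for every n, since `H` is one of its own images.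
  backward : DensityLE k (AllImages H) (Singleton H)
  backward t = 0 , λ n _ m Gs free m≤ →
    Gs , (λ { F refl → free F (image-refl H) }) ,
    λ i → ≤-trans (*-monoʳ-≤ (suc t) (m≤ i)) (m≤m+n _ _)
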